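{- Let $p>3$ be a prime. Then $$\sum_{k=0}^{(p-1)/2}\frac{\binom{2k}k\binom{4k}{2k}}{(2k-1)64^k}\equiv(-1)^{\frac{p+1}2}\frac{p+1}2\pmod{p^2},$$ $$\sum_{k=0}^{(p-1)/2}\frac{\binom{2k}k\binom{3k}{k}}{(2k-1)27^k}\equiv\frac19\Big(\frac p3\Big)\big(2^{p+1}-7-6p\big)\pmod{p^2},$$ $$\sum_{k=0}^{(p-1)/2}\frac{\binom{3k}k\binom{6k}{3k}}{(2k-1)432^k}\equiv-\frac19\Big(\frac p3\Big)\big(2^{p+1}+2+3p\big)\pmod{p^2}.$$
   Context: $\big(\frac p3\big)$ is the Legendre symbol ($1$ if $p\equiv1\pmod 3$, $-1$ if $p\equiv 2\pmod 3$). Congruences are in the ring of rationals with denominators prime to $p$. -}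

module Defs where

open import Data.Nat as ℕ using (ℕ; zero; suc; _∸_)
open import Data.Nat.Combinatorics using (_C_)
open import Data.Nat.Divisibility using (_∣_)
open import Data.Integer as ℤ using (ℤ; +_)
open import Data.Rational as ℚ using (ℚ; _/_; ↥_; ↧ₙ_; _-_; _*_; _+_; -_)
open import Data.Product using (_×_)
open import Relation.Nullary using (¬_)

-- x ≡ y (mod m) in the ring of rationals with denominators prime to p
-- (m is a power of p here): writing x - y = a/b in lowest terms,
-- p does not divide b and m divides a.
_≡_[mod_∣_] : ℚ → ℚ → ℕ → ℕ → Set
x ≡ y [mod m ∣ p ] = (¬ (p ∣ ↧ₙ (x - y))) × (m ∣ ℤ.∣ ↥ (x - y) ∣)

inv2k-1 : ℕ → ℚ
inv2k-1 zero = ℚ.-_ ℚ.1ℚ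
inv2k-1 (suc k) = + 1 / suc (2 ℕ.* k)

-- rational a / b for natural b (b = 0 never occurs in our uses; maps to 0)
_/ℕ_ : ℕ → ℕ → ℚ
a /ℕ zero = ℚ.0ℚ
a /ℕ suc b = + a / suc b

Σ≤ : ℕ → (ℕ → ℚ) → ℚ
Σ≤ zero f = f 0
Σ≤ (suc n) f = Σ≤ n f + f (suc n)

ℚpow : ℚ → ℕ → ℚ
ℚpow x zero = ℚ.1ℚ
ℚpow x (suc n) = x * ℚpow x n

-- Legendre symbol (p/3) for primes p > 3
leg3 : ℕ → ℚ
leg3 p with p ℕ.% 3
... | 1 = ℚ.1ℚ
... | _ = ℚ.-_ ℚ.1ℚ

t1 t2 t3 : ℕ → ℚ
t1 k = ((((2 ℕ.* k) C k) ℕ.* ((4 ℕ.* k) C (2 ℕ.* k))) /ℕ (64 ℕ.^ k)) * inv2k-1 k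
t2 k = ((((2 ℕ.* k) C k) ℕ.* ((3 ℕ.* k) C k)) /ℕ (27 ℕ.^ k)) * inv2k-1 k
t3 k = ((((3 ℕ.* k) C k) ℕ.* ((6 ℕ.* k) C (3 ℕ.* k))) /ℕ (432 ℕ.^ k)) * inv2k-1 k

{-# OPTIONS --safe #-}
-- Put n = (p-1)/2 and F(a) = ∑_{k ≤ n} binom(a,k) binom(-1-a,k) / (2k-1); the three sums are F(-1/4), F(-1/3)
-- and F(-1/6), and F(a) = F(-1-a). Telescoping in k gives (2a-1) F(a) - (2a+1) F(a-1) = 2 ∏_{i ≤ n} (1 - a²/i²).
-- One of a, -1-a has the form r + pt with 0 ≤ r ≤ n; for a = j + pt with 1 ≤ j ≤ n the product is pt/j modulo p²,
-- so climbing from F(pt) to F(r + pt) yields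
--   F(r + pt) ≡ -(2r+1) (1 + pt (D(n) - 2 D(r)))  (mod p²),   D(m) = ∑_{j ≤ m} (2/(2j-1) - 1/j) = 2 H_{2m} - 2 H_m.
-- Here p D(n) ≡ 2^{p+1} - 4 by expanding 2^p = ∑ binom(p,k), and D(r) modulo p is compared with D(n) or with 0
-- by splitting the harmonic sums into residue classes modulo 2 or 3 and translating the indices by p.

module Submission where

open import Defs
open import Data.Fin.Base using (zero; suc)
open import Data.Integer using (+_)
open import Data.Integer as ℤ using (ℤ; _+_; _*_; _-_; -_)
import Data.Integer.Properties as ℤ
open import Data.Integer.Tactic.RingSolver using (solve)
open import Data.List.Base using (_∷_; [])
open import Data.Nat as ℕ using (ℕ; zero; suc; _≤_; _<_; _>_; _∸_; _/_; _%_; _^_; _!; s≤s; z≤n)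
open import Data.Nat.Combinatorics using (_C_; nCk≡n!/k![n-k]!; k![n∸k]!∣n!; k>n⇒nCk≡0; nCk+nC[k+1]≡[n+1]C[k+1]; nCn≡1)
open import Data.Nat.Coprimality as Coprimality using (Coprime; coprime-Bézout; coprime-divisor)
open import Data.Nat.Divisibility using (_∣_; _∣?_; divides; ∣-trans; ∣1⇒≡1; _∣0; >⇒∤)
open import Data.Nat.DivMod using (_divMod_; result; [m+kn]%n≡m%n)
import Data.Nat.DivMod as ℕ using (m/n*n≡m; m*n/n≡m)
open import Data.Nat.GCD using (module Bézout)
open import Data.Nat.Primality using (Prime; euclidsLemma; prime⇒irreducible; ¬prime[1])
import Data.Nat.Properties as ℕ
import Data.Nat.Tactic.RingSolver as ℕ-Solver
open import Data.Product using (_×_; _,_; ∃; proj₁; proj₂)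
open import Data.Rational as ℚ using (ℚ; mkℚ; toℚᵘ; 1ℚ)
import Data.Rational.Properties as ℚ
open import Data.Rational.Unnormalised as ℚᵘ using (ℚᵘ; mkℚᵘ; _≃_; *≡*)
import Data.Rational.Unnormalised.Properties as ℚᵘ
open import Data.Sum using (inj₁; inj₂; [_,_]′)
open import Relation.Binary.PropositionalEquality using (_≡_; refl; sym; trans; cong; cong₂; subst; module ≡-Reasoning)
open import Relation.Nullary using (¬_; Dec; yes; no; contradiction)

-- All arithmetic is done with integers: `inv` picks representatives of inverses modulo p², and `t`
-- is an integer with d t ≈ -1, so that the fraction -e/d becomes the integer r + pt with e + d r =
-- p. Rational numbers return only through `Represents`. Two constraints shape the proof. The
-- recurrence yields F(b + 1) from F(b) only if 2b + 1 is invertible; for b = j + pt this holds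
-- while j < n and fails at j = n, where 2j + 1 = p. This is why r ≤ n is required, and why the
-- symmetry a ↔ -1-a must be available: the other root would in general lie beyond n. Secondly, the
-- harmonic sums always appear multiplied by p, so identities among them are needed only modulo p,
-- where indices may be translated by p and reflected. The coefficients passed to `linear` are
-- certificates: they write the difference of the two sides as a combination of the hypotheses,
-- including p² itself, and the ring solver checks the resulting identity.

infix 4 _≈_[_]
infixl 6 _⊞_
infixl 7 _·_

-- Congruences between integers.

record _≈_[_] (x y m : ℤ) : Set where
  constructor mod
  field
    quotient : ℤ
    equality : x - y ≡ quotient * m

_·_ : ∀ {x y m} c → x ≈ y [ m ] → c * x ≈ c * y [ m ]
_·_ {x} {y} {m} c (mod q e) = mod (c * q) (trans (lhs c x y) (trans (cong (c *_) e) (rhs c q m)))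
  where
  lhs : ∀ c x y → c * x - c * y ≡ c * (x - y)
  lhs c x y = solve (c ∷ x ∷ y ∷ [])
  rhs : ∀ c q m → c * (q * m) ≡ c * q * m
  rhs c q m = solve (c ∷ q ∷ m ∷ [])

_⊞_ : ∀ {x y z w m} → x ≈ y [ m ] → z ≈ w [ m ] → x + z ≈ y + w [ m ]
_⊞_ {x} {y} {z} {w} {m} (mod q e) (mod r f) =
  mod (q + r) (trans (lhs x y z w) (trans (cong₂ _+_ e f) (rhs q r m)))
  where
  lhs : ∀ x y z w → x + z - (y + w) ≡ (x - y) + (z - w)
  lhs x y z w = solve (x ∷ y ∷ z ∷ w ∷ [])
  rhs : ∀ q r m → q * m + r * m ≡ (q + r) * m
  rhs q r m = solve (q ∷ r ∷ m ∷ [])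

-- Proves a congruence by exhibiting the difference of its sides as a linear combination of known ones.
linear : ∀ {x y l r m} → l ≈ r [ m ] → x - y ≡ l - r → x ≈ y [ m ]
linear (mod q e) f = mod q (trans f e)

modulus : ∀ m → m ≈ + 0 [ m ]
modulus m = mod (+ 1) (solve (m ∷ []))

≡⇒≈ : ∀ {x y m} → x ≡ y → x ≈ y [ m ]
≡⇒≈ {x} {m = m} refl = mod (+ 0) (solve (x ∷ m ∷ []))

≈-trans : ∀ {x y z m} → x ≈ y [ m ] → y ≈ z [ m ] → x ≈ z [ m ]
≈-trans {x} {y} {z} h₁ h₂ = linear (h₁ ⊞ h₂) (solve (x ∷ y ∷ z ∷ []))

≈-sym : ∀ {x y m} → x ≈ y [ m ] → y ≈ x [ m ]
≈-sym {x} {y} h = linear ((- + 1) · h) (solve (x ∷ y ∷ []))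

cancel : ∀ {x y m} k i → i * k ≈ + 1 [ m ] → k * x ≈ k * y [ m ] → x ≈ y [ m ]
cancel {x} {y} k i hi h = linear (i · h ⊞ (y - x) · hi) (solve (x ∷ y ∷ k ∷ i ∷ []))

1+x+y≡x+y+1 : ∀ x y → + 1 + x + y ≡ x + y + + 1
1+x+y≡x+y+1 x y = solve (x ∷ y ∷ [])

partial-sum : (ℕ → ℤ) → ℕ → ℤ
partial-sum f zero    = f 0
partial-sum f (suc m) = partial-sum f m + f (suc m)

-- The sum F(a) modulo p² and its recurrence in a.

-- Truncations at n = (p - 1) / 2, modulo p², of series with denominators below p; inv is an inversion modulo p².
module Truncated
  (n : ℕ) (inv : ℕ → ℤ)
  (inverse : ∀ k → k < 2 ℕ.* n → inv (suc k) * + suc k ≈ + 1 [ + suc (2 ℕ.* n) * + suc (2 ℕ.* n) ])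
  where

  P M : ℤ
  P = + suc (2 ℕ.* n)
  M = P * P

  P≡1+2n : P ≡ + 1 + + 2 * + n
  P≡1+2n = cong (λ x → + 1 + x) (ℤ.pos-* 2 n)

  n≤2n : n ≤ 2 ℕ.* n
  n≤2n = ℕ.m≤m+n n _

  inverse-≤n : ∀ k → k < n → inv (suc k) * (+ 1 + + k) ≈ + 1 [ M ]
  inverse-≤n k k<n = inverse k (ℕ.≤-trans k<n n≤2n)

  inverse-odd : ∀ k → k < n → inv (suc (2 ℕ.* k)) * (+ 1 + + 2 * + k) ≈ + 1 [ M ]
  inverse-odd k k<n =
    ≈-trans (≡⇒≈ (cong (λ x → inv (suc (2 ℕ.* k)) * (+ 1 + x)) (sym (ℤ.pos-* 2 k))))
            (inverse (2 ℕ.* k) (ℕ.*-monoʳ-< 2 k<n))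

  -- u a k is binom(a, k) binom(-1-a, k).
  u : ℤ → ℕ → ℤ
  u a zero    = + 1
  u a (suc k) = - ((a - + k) * (a + + k + + 1)) * (inv (suc k) * inv (suc k)) * u a k

  -- The product of the factors 1 - a²/i², which is also binom(a-1, k) binom(-1-a, k).
  v : ℤ → ℕ → ℤ
  v a zero    = + 1
  v a (suc k) = v a k * (+ 1 - a * a * (inv (suc k) * inv (suc k)))

  -- The weight 1/(2k-1) is -1 at k = 0 and the inverse of `suc (2 * m)` at k = m + 1, so only
  -- positive numbers are ever inverted.
  weighted-sum : (ℕ → ℤ) → ℕ → ℤ
  weighted-sum f zero    = - f 0
  weighted-sum f (suc m) = weighted-sum f m + f (suc m) * inv (suc (2 ℕ.* m))

  F : ℤ → ℕ → ℤ
  F a = weighted-sum (u a)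

  D : ℕ → ℤ
  D zero    = + 0
  D (suc j) = D j + (+ 2 * inv (suc (2 ℕ.* j)) - inv (suc j))

  -- The absorption identity (a-k) binom(a, k) = a binom(a-1, k), multiplied by binom(-1-a, k).
  u-v-upper : ∀ a k → k ≤ n → (a - + k) * u a k ≈ a * v a k [ M ]
  u-v-upper a zero    _   = ≡⇒≈ (solve (a ∷ []))
  u-v-upper a (suc k) k<n =
    step P a (+ k) (inv (suc k)) (u a k) (v a k) (u-v-upper a k (ℕ.<⇒≤ k<n)) (inverse-≤n k k<n)
    where
    step : ∀ P a K i u v → (a - K) * u ≈ a * v [ P * P ] → i * (+ 1 + K) ≈ + 1 [ P * P ] →
      (a - (+ 1 + K)) * (- ((a - K) * (a + K + + 1)) * (i * i) * u) ≈ a * (v * (+ 1 - a * a * (i * i))) [ P * P ]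
    step P a K i u v h hi =
      linear ((- ((a - + 1 - K) * (a + K + + 1) * (i * i))) · h ⊞ (a * v * ((+ 1 + K) * i + + 1)) · hi)
        (solve (a ∷ K ∷ i ∷ u ∷ v ∷ []))

  -- Absorption in the other factor: (b+1+k) binom(-1-b, k) = (b+1) binom(-2-b, k), multiplied by
  -- binom(b, k).
  u-v-lower : ∀ b k → k ≤ n → (b + + 1 + + k) * u b k ≈ (b + + 1) * v (b + + 1) k [ M ]
  u-v-lower b zero    _   = ≡⇒≈ (solve (b ∷ []))
  u-v-lower b (suc k) k<n =
    step P b (+ k) (inv (suc k)) (u b k) (v (b + + 1) k) (u-v-lower b k (ℕ.<⇒≤ k<n)) (inverse-≤n k k<n)
    where
    step : ∀ P b K i u v → (b + + 1 + K) * u ≈ (b + + 1) * v [ P * P ] → i * (+ 1 + K) ≈ + 1 [ P * P ] →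
      (b + + 1 + (+ 1 + K)) * (- ((b - K) * (b + K + + 1)) * (i * i) * u)
        ≈ (b + + 1) * (v * (+ 1 - (b + + 1) * (b + + 1) * (i * i))) [ P * P ]
    step P b K i u v h hi =
      linear ((- ((b - K) * (b + K + + 2) * (i * i))) · h ⊞ ((b + + 1) * v * ((+ 1 + K) * i + + 1)) · hi)
        (solve (b ∷ K ∷ i ∷ u ∷ v ∷ []))

  -- Expressed through v = `v (b + 1) m`, the terms of index m + 1 combine to -2 (2m+1) (b+1)² v /
  -- (m+1)² before weighting. The weight cancels 2m+1 and leaves exactly the increment of 2v.
  F-recurrence : ∀ b m → m ≤ n →
    (+ 2 * b + + 1) * F (b + + 1) m - (+ 2 * b + + 3) * F b m ≈ + 2 * v (b + + 1) m [ M ]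
  F-recurrence b zero    _   = ≡⇒≈ (solve (b ∷ []))
  F-recurrence b (suc m) m<n =
    step P b (+ m) (inv (suc m)) (inv (suc (2 ℕ.* m))) (u (b + + 1) m) (u b m) (v (b + + 1) m) (F (b + + 1) m) (F b m)
      (F-recurrence b m m≤n) (u-v-upper (b + + 1) m m≤n) (u-v-lower b m m≤n) (inverse-odd m m<n)
    where
    m≤n = ℕ.<⇒≤ m<n
    step : ∀ P b K i j u u′ v F F′ →
      (+ 2 * b + + 1) * F - (+ 2 * b + + 3) * F′ ≈ + 2 * v [ P * P ] →
      (b + + 1 - K) * u ≈ (b + + 1) * v [ P * P ] → (b + + 1 + K) * u′ ≈ (b + + 1) * v [ P * P ] →
      j * (+ 1 + + 2 * K) ≈ + 1 [ P * P ] →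
      (+ 2 * b + + 1) * (F + - ((b + + 1 - K) * (b + + 1 + K + + 1)) * (i * i) * u * j)
        - (+ 2 * b + + 3) * (F′ + - ((b - K) * (b + K + + 1)) * (i * i) * u′ * j)
        ≈ + 2 * (v * (+ 1 - (b + + 1) * (b + + 1) * (i * i))) [ P * P ]
    step P b K i j u u′ v F F′ h h₁ h₂ hj =
      linear (h ⊞ (- ((+ 2 * b + + 1) * (b + K + + 2) * (i * i) * j)) · h₁
                ⊞ ((+ 2 * b + + 3) * (b - K) * (i * i) * j) · h₂
                ⊞ (- (+ 2 * (i * i) * (b + + 1) * (b + + 1) * v)) · hj)
        (solve (b ∷ K ∷ i ∷ j ∷ u ∷ u′ ∷ v ∷ F ∷ F′ ∷ []))

  -- The quotient of the two products telescopes: (i-a-1)/(i-a) contributes -a/(k-a), and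
  -- (i+a+1)/(i+a) contributes (a+k+1)/(a+1).
  v-shift : ∀ a k → k ≤ n →
    (a + + 1) * (a - + k) * v (a + + 1) k ≈ a * (a + + k + + 1) * v a k [ M ]
  v-shift a zero    _   = ≡⇒≈ (solve (a ∷ []))
  v-shift a (suc k) k<n =
    step P a (+ k) (inv (suc k)) (v a k) (v (a + + 1) k) (v-shift a k (ℕ.<⇒≤ k<n)) (inverse-≤n k k<n)
    where
    step : ∀ P a K i v v′ →
      (a + + 1) * (a - K) * v′ ≈ a * (a + K + + 1) * v [ P * P ] → i * (+ 1 + K) ≈ + 1 [ P * P ] →
      (a + + 1) * (a - (+ 1 + K)) * (v′ * (+ 1 - (a + + 1) * (a + + 1) * (i * i)))
        ≈ a * (a + (+ 1 + K) + + 1) * (v * (+ 1 - a * a * (i * i))) [ P * P ]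
    step P a K i v v′ h hi =
      linear ((- (i * i * (K + a + + 2) * (a - K - + 1))) · h
        ⊞ (((+ 1 + K) * i + + 1) * (a * (a + K + + 2) * v - (a + + 1) * (a - + 1 - K) * v′)) · hi)
        (solve (a ∷ K ∷ i ∷ v ∷ v′ ∷ []))

  -- Climbing from pt to r + pt.

  module _ (t : ℤ) where

    v-initial : ∀ k → v (P * t) k ≈ + 1 [ M ]
    v-initial zero    = ≡⇒≈ refl
    v-initial (suc k) = step P t (inv (suc k)) (v (P * t) k) (v-initial k)
      where
      step : ∀ P t i v → v ≈ + 1 [ P * P ] → v * (+ 1 - P * t * (P * t) * (i * i)) ≈ + 1 [ P * P ]
      step P t i v h = linear (h ⊞ (- (v * t * t * (i * i))) · modulus (P * P)) (solve (P ∷ t ∷ i ∷ v ∷ []))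

    -- Both factors of v-shift at k = n equal j + 1/2 modulo p, and a v is a multiple of p.
    av≈Pt : ∀ j → j ≤ n → (+ j + P * t) * v (+ j + P * t) n ≈ P * t [ M ]
    av≈Pt zero    _   rewrite ℤ.+-identityˡ (P * t) = base P t (v (P * t) n) (v-initial n)
      where
      base : ∀ P t v → v ≈ + 1 [ P * P ] → P * t * v ≈ P * t [ P * P ]
      base P t v h = linear ((P * t) · h) (solve (P ∷ t ∷ v ∷ []))
    av≈Pt (suc j) j<n rewrite 1+x+y≡x+y+1 (+ j) (P * t) =
      step P t (+ j) (+ n) (inv (suc (2 ℕ.* j))) (v a n) (v (a + + 1) n)
        (≡⇒≈ (sym P≡1+2n)) (v-shift a n ℕ.≤-refl) (av≈Pt j (ℕ.<⇒≤ j<n)) (inverse-odd j j<n)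
      where
      a = + j + P * t
      step : ∀ P t J N i v v′ → + 1 + + 2 * N ≈ P [ P * P ] →
        (J + P * t + + 1) * (J + P * t - N) * v′ ≈ (J + P * t) * (J + P * t + N + + 1) * v [ P * P ] →
        (J + P * t) * v ≈ P * t [ P * P ] → i * (+ 1 + + 2 * J) ≈ + 1 [ P * P ] →
        (J + P * t + + 1) * v′ ≈ P * t [ P * P ]
      step P t J N i v v′ hP h hz hi =
        -- Since 2N ≈ P - 1, twice `J + P * t - N` is 2J + 1 + P(2t - 1), and
        -- `i * (1 - i * P * (2t - 1))` is its inverse to first order in P.
        linear ((+ 2 * (i * (+ 1 - i * P * (+ 2 * t - + 1)))) · h
            ⊞ (i * (+ 1 - i * P * (+ 2 * t - + 1)) * ((J + P * t + + 1) * v′ + (J + P * t) * v)) · hP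
            ⊞ (i * (+ 1 - i * P * (+ 2 * t - + 1)) * (+ 2 * J + + 1 + + 2 * P * t + P)) · hz
            ⊞ ((+ 1 - i * P * (+ 2 * t - + 1)) * (P * t - (J + P * t + + 1) * v′)) · hi
            ⊞ (+ 2 * (i * (+ 1 - i * P * (+ 2 * t - + 1))) * t
               - i * i * (+ 2 * t - + 1) * (+ 2 * t - + 1) * (P * t - (J + P * t + + 1) * v′)) · modulus (P * P))
          (solve (P ∷ t ∷ J ∷ N ∷ i ∷ v ∷ v′ ∷ []))

    -- The factor of index 0 already supplies pt, so the later ones matter only modulo p. There they
    -- are k/(k+1), and their product telescopes.
    u-initial : ∀ k → k < n → u (P * t) (suc k) ≈ - (P * t) * inv (suc k) [ M ]
    u-initial zero    k<n = base P t (inv 1) (inverse-≤n 0 k<n)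
      where
      base : ∀ P t i → i * (+ 1 + + 0) ≈ + 1 [ P * P ] →
        - ((P * t - + 0) * (P * t + + 0 + + 1)) * (i * i) * + 1 ≈ - (P * t) * i [ P * P ]
      base P t i h = linear ((- (P * t * i)) · h ⊞ (- (t * t * (i * i))) · modulus (P * P)) (solve (P ∷ t ∷ i ∷ []))
    u-initial (suc k) k<n =
      step P t (+ suc k) (inv (suc k)) (inv (suc (suc k))) (u (P * t) (suc k))
        (u-initial k (ℕ.<⇒≤ k<n)) (inverse-≤n k (ℕ.<⇒≤ k<n)) (inverse-≤n (suc k) k<n)
      where
      step : ∀ P t K i i′ u → u ≈ - (P * t) * i [ P * P ] → i * K ≈ + 1 [ P * P ] → i′ * (+ 1 + K) ≈ + 1 [ P * P ] →
        - ((P * t - K) * (P * t + K + + 1)) * (i′ * i′) * u ≈ - (P * t) * i′ [ P * P ]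
      step P t K i i′ u h hi hi′ =
        linear ((- ((P * t - K) * (P * t + K + + 1) * (i′ * i′))) · h
            ⊞ (- (P * t * i′ * ((K + + 1) * i′))) · hi ⊞ (- (P * t * i′)) · hi′
            ⊞ (i′ * i′ * (t * t) * i * (P * t + + 1)) · modulus (P * P))
          (solve (P ∷ t ∷ K ∷ i ∷ i′ ∷ u ∷ []))

    -- This is the origin of `D`: the partial fractions 1/(k(2k-1)) = 2/(2k-1) - 1/k.
    F-initial : ∀ m → m ≤ n → F (P * t) m ≈ - (+ 1 + P * t * D m) [ M ]
    F-initial zero    _   = ≡⇒≈ (base (P * t))
      where
      base : ∀ x → - + 1 ≡ - (+ 1 + x * + 0)
      base x = solve (x ∷ [])
    F-initial (suc m) m<n =
      step P t (+ m) (inv (suc m)) (inv (suc (2 ℕ.* m))) (D m) (F (P * t) m) (u (P * t) (suc m))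
        (F-initial m (ℕ.<⇒≤ m<n)) (u-initial m m<n) (inverse-≤n m m<n) (inverse-odd m m<n)
      where
      step : ∀ P t K i j D F u → F ≈ - (+ 1 + P * t * D) [ P * P ] → u ≈ - (P * t) * i [ P * P ] →
        i * (+ 1 + K) ≈ + 1 [ P * P ] → j * (+ 1 + + 2 * K) ≈ + 1 [ P * P ] →
        F + u * j ≈ - (+ 1 + P * t * (D + (+ 2 * j - i))) [ P * P ]
      step P t K i j D F u h hu hi hj =
        linear (h ⊞ j · hu ⊞ (- (P * t * + 2 * j)) · hi ⊞ (P * t * i) · hj)
          (solve (P ∷ t ∷ K ∷ i ∷ j ∷ D ∷ F ∷ u ∷ []))

    -- Modulo p², one step of the recurrence changes F/(2r+1) by 2pt/((r+1)(2r+1)): the term 2v and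
    -- the 2pt hidden in 2b+1 both contribute. By partial fractions this is 2pt times the increment
    -- of `D`.
    F-value : ∀ r → r ≤ n → F (+ r + P * t) n ≈ - (+ 1 + + 2 * + r) * (+ 1 + P * t * (D n - + 2 * D r)) [ M ]
    F-value zero    _   rewrite ℤ.+-identityˡ (P * t) =
      ≈-trans (F-initial n ℕ.≤-refl) (≡⇒≈ (base (P * t) (D n)))
      where
      base : ∀ x y → - (+ 1 + x * y) ≡ - (+ 1 + + 2 * + 0) * (+ 1 + x * (y - + 2 * + 0))
      base x y = solve (x ∷ y ∷ [])
    F-value (suc r) r<n rewrite 1+x+y≡x+y+1 (+ r) (P * t) =
      step P t (+ r) (inv (suc r)) (inv (suc (2 ℕ.* r))) (D n) (D r) (F (+ r + P * t) n) (F (+ r + P * t + + 1) n)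
        (v (+ r + P * t + + 1) n)
        (inverse-≤n r r<n) (inverse-odd r r<n) (F-value r (ℕ.<⇒≤ r<n))
        (≈-trans (≡⇒≈ (cong (λ x → x * v x n) (sym (1+x+y≡x+y+1 (+ r) (P * t))))) (av≈Pt (suc r) r<n))
        (F-recurrence (+ r + P * t) n ℕ.≤-refl)
      where
      -- `i * (1 - i * (P * t))` inverts J + 1 + Pt modulo p²; its second term disappears against
      -- the factor P of the right-hand side.
      divide : ∀ P t J i v → i * (+ 1 + J) ≈ + 1 [ P * P ] →
        (J + P * t + + 1) * v ≈ P * t [ P * P ] → v ≈ P * t * i [ P * P ]
      divide P t J i v hi h =
        linear ((i * (+ 1 - i * (P * t))) · h ⊞ (- ((+ 1 - i * (P * t)) * v)) · hi
            ⊞ (i * i * t * t * v - i * i * t * t) · modulus (P * P))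
          (solve (P ∷ t ∷ J ∷ i ∷ v ∷ []))
      unit : ∀ P t J j → j * (+ 1 + + 2 * J) ≈ + 1 [ P * P ] →
        j * (+ 1 - + 2 * j * (P * t)) * (+ 2 * (J + P * t) + + 1) ≈ + 1 [ P * P ]
      unit P t J j hj =
        linear ((+ 1 - + 2 * j * (P * t)) · hj ⊞ (- (+ 4 * j * j * t * t)) · modulus (P * P))
          (solve (P ∷ t ∷ J ∷ j ∷ []))
      product : ∀ P t J i j Dn D F F′ v →
        i * (+ 1 + J) ≈ + 1 [ P * P ] → j * (+ 1 + + 2 * J) ≈ + 1 [ P * P ] →
        F ≈ - (+ 1 + + 2 * J) * (+ 1 + P * t * (Dn - + 2 * D)) [ P * P ] → v ≈ P * t * i [ P * P ] →
        (+ 2 * (J + P * t) + + 1) * F′ - (+ 2 * (J + P * t) + + 3) * F ≈ + 2 * v [ P * P ] →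
        (+ 2 * (J + P * t) + + 1) * F′
          ≈ (+ 2 * (J + P * t) + + 1) * (- (+ 1 + + 2 * (+ 1 + J)) * (+ 1 + P * t * (Dn - + 2 * (D + (+ 2 * j - i))))) [ P * P ]
      product P t J i j Dn D F F′ v hi hj hF hv h =
        linear (h ⊞ (+ 2 * (J + P * t) + + 3) · hF ⊞ + 2 · hv
            ⊞ (+ 8 * (P * t) * (+ 1 + J)) · hi ⊞ (- (+ 4 * (P * t) * (+ 3 + + 2 * J))) · hj
            ⊞ (t * t * (+ 4 * (Dn - + 2 * D) - + 4 * (+ 3 + + 2 * J) * (+ 2 * j - i))) · modulus (P * P))
          (solve (P ∷ t ∷ J ∷ i ∷ j ∷ Dn ∷ D ∷ F ∷ F′ ∷ v ∷ []))
      step : ∀ P t J i j Dn D F F′ v →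
        i * (+ 1 + J) ≈ + 1 [ P * P ] → j * (+ 1 + + 2 * J) ≈ + 1 [ P * P ] →
        F ≈ - (+ 1 + + 2 * J) * (+ 1 + P * t * (Dn - + 2 * D)) [ P * P ] →
        (J + P * t + + 1) * v ≈ P * t [ P * P ] →
        (+ 2 * (J + P * t) + + 1) * F′ - (+ 2 * (J + P * t) + + 3) * F ≈ + 2 * v [ P * P ] →
        F′ ≈ - (+ 1 + + 2 * (+ 1 + J)) * (+ 1 + P * t * (Dn - + 2 * (D + (+ 2 * j - i)))) [ P * P ]
      step P t J i j Dn D F F′ v hi hj hF hv h =
        cancel (+ 2 * (J + P * t) + + 1) (j * (+ 1 - + 2 * j * (P * t))) (unit P t J j hj)
          (product P t J i j Dn D F F′ v hi hj hF (divide P t J i v hi hv) h)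

  -- Harmonic numbers modulo p.

  ≈-mod-P : ∀ {x y} → x ≈ y [ M ] → x ≈ y [ P ]
  ≈-mod-P {x} {y} (mod q e) = mod (q * P) (trans e (assoc q P))
    where
    assoc : ∀ q P → q * (P * P) ≡ q * P * P
    assoc q P = solve (q ∷ P ∷ [])

  P·_ : ∀ {x y} → x ≈ y [ P ] → P * x ≈ P * y [ M ]
  P·_ {x} {y} (mod q e) = mod q (trans (lhs P x y) (trans (cong (P *_) e) (rhs P q)))
    where
    lhs : ∀ P x y → P * x - P * y ≡ P * (x - y)
    lhs P x y = solve (P ∷ x ∷ y ∷ [])
    rhs : ∀ P q → P * (q * P) ≡ q * (P * P)
    rhs P q = solve (P ∷ q ∷ [])

  inverse-mod-P : ∀ k → k < 2 ℕ.* n → inv (suc k) * + suc k ≈ + 1 [ P ]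
  inverse-mod-P k k<2n = ≈-mod-P (inverse k k<2n)

  -- The change of index behind all the harmonic identities: doubling, tripling and reflection are c
  -- = ±1, ±2, ±3, with the indices compared only modulo p.
  inv-scale : ∀ c x y → x < 2 ℕ.* n → y < 2 ℕ.* n → + suc y ≈ c * + suc x [ P ] → c * inv (suc y) ≈ inv (suc x) [ P ]
  inv-scale c x y x<2n y<2n h = alg c (+ suc x) (+ suc y) (inv (suc x)) (inv (suc y)) h (inverse-mod-P x x<2n) (inverse-mod-P y y<2n)
    where
    alg : ∀ {m} c X Y i j → Y ≈ c * X [ m ] → i * X ≈ + 1 [ m ] → j * Y ≈ + 1 [ m ] → c * j ≈ i [ m ]
    alg c X Y i j h hi hj = linear ((- (c * j)) · hi ⊞ (- (j * i)) · h ⊞ i · hj) (solve (c ∷ X ∷ Y ∷ i ∷ j ∷ []))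

  H : ℕ → ℤ
  H zero    = + 0
  H (suc m) = H m + inv (suc m)

  H-double : ∀ m → H (2 ℕ.* suc m) ≈ H (2 ℕ.* m) + inv (1 ℕ.+ 2 ℕ.* m) + inv (2 ℕ.+ 2 ℕ.* m) [ P ]
  H-double m = ≡⇒≈ (cong H (ℕ.*-suc 2 m))

  H-triple : ∀ m → H (3 ℕ.* suc m) ≈ H (3 ℕ.* m) + inv (1 ℕ.+ 3 ℕ.* m) + inv (2 ℕ.+ 3 ℕ.* m) + inv (3 ℕ.+ 3 ℕ.* m) [ P ]
  H-triple m = ≡⇒≈ (cong H (ℕ.*-suc 3 m))

  D≈H : ∀ m → m ≤ n → D m ≈ + 2 * H (2 ℕ.* m) - + 2 * H m [ P ]
  D≈H zero    _   = ≡⇒≈ refl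
  D≈H (suc m) m<n =
    step (D m) (H (2 ℕ.* m)) (H (2 ℕ.* suc m)) (H m) (inv (suc (2 ℕ.* m))) (inv (suc (suc (2 ℕ.* m)))) (inv (suc m)) (D≈H m (ℕ.<⇒≤ m<n)) (H-double m)
      (inv-scale (+ 2) m (suc (2 ℕ.* m)) (ℕ.≤-trans m<n n≤2n) 2m+2≤2n
        (≡⇒≈ (trans (cong (λ x → + 2 + x) (ℤ.pos-* 2 m)) (double (+ m)))))
    where
    2m+2≤2n : 2 ℕ.+ 2 ℕ.* m ≤ 2 ℕ.* n
    2m+2≤2n = ℕ.≤-trans (ℕ.≤-reflexive (sym (ℕ.*-suc 2 m))) (ℕ.*-monoʳ-≤ 2 m<n)
    double : ∀ x → + 2 + + 2 * x ≡ + 2 * (+ 1 + x)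
    double x = solve (x ∷ [])
    step : ∀ {M} D G G′ H i j k → D ≈ + 2 * G - + 2 * H [ M ] → G′ ≈ G + i + j [ M ] → + 2 * j ≈ k [ M ] →
      D + (+ 2 * i - k) ≈ + 2 * G′ - + 2 * (H + k) [ M ]
    step D G G′ H i j k h hG hj = linear (h ⊞ (- + 2) · hG ⊞ (- + 1) · hj) (solve (D ∷ G ∷ G′ ∷ H ∷ i ∷ j ∷ k ∷ []))

  private
    m<n-from : ∀ {m k s} → suc m ℕ.+ k ≡ s → m < s
    m<n-from {m} {k} e = ℕ.≤-trans (ℕ.m≤m+n (suc m) k) (ℕ.≤-reflexive e)

    k<n-from : ∀ {m k s} → m ℕ.+ suc k ≡ s → k < s
    k<n-from {m} {k} e = ℕ.≤-trans (ℕ.m≤n+m (suc k) m) (ℕ.≤-reflexive e)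

    move : ∀ {m k s} → suc m ℕ.+ k ≡ s → m ℕ.+ suc k ≡ s
    move {m} {k} e = trans (ℕ.+-suc m k) e

  -- The even indices up to 2m contribute H m / 2; an odd index 2i+1 is -2(n-i) modulo p.
  H-halves : ∀ m k → m ℕ.+ k ≡ n → + 2 * H (2 ℕ.* m) + H n ≈ H m + H k [ P ]
  H-halves zero    k refl = ≡⇒≈ refl
  H-halves (suc m) k e =
    step (H (2 ℕ.* m)) (H (2 ℕ.* suc m)) (H n) (H m) (H k) (inv (suc (2 ℕ.* m))) (inv (suc (suc (2 ℕ.* m)))) (inv (suc m)) (inv (suc k))
      (H-halves m (suc k) (move e)) (H-double m)
      (inv-scale (+ 2) m (suc (2 ℕ.* m)) (ℕ.≤-trans m<n n≤2n) 2m+2≤2n (≡⇒≈ (trans (cong (λ x → + 2 + x) (ℤ.pos-* 2 m)) (even (+ m)))))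
      (inv-scale (- + 2) k (2 ℕ.* m) (ℕ.≤-trans (k<n-from {m} (move e)) n≤2n) (ℕ.<⇒≤ 2m+2≤2n)
        (≈-trans (≡⇒≈ (cong (λ x → + 1 + x) (ℤ.pos-* 2 m)))
          (odd P (+ m) (+ k) (+ n) (≡⇒≈ (cong +_ e)) (≡⇒≈ (sym P≡1+2n)))))
    where
    m<n : m < n
    m<n = m<n-from e
    2m+2≤2n : 2 ℕ.+ 2 ℕ.* m ≤ 2 ℕ.* n
    2m+2≤2n = ℕ.≤-trans (ℕ.≤-reflexive (sym (ℕ.*-suc 2 m))) (ℕ.*-monoʳ-≤ 2 m<n)
    even : ∀ x → + 2 + + 2 * x ≡ + 2 * (+ 1 + x)
    even x = solve (x ∷ [])
    odd : ∀ P x y z → + 1 + x + y ≈ z [ P ] → + 1 + + 2 * z ≈ P [ P ] → + 1 + + 2 * x ≈ - + 2 * (+ 1 + y) [ P ]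
    odd P x y z h hP = linear (+ 2 · h ⊞ hP ⊞ modulus P) (solve (P ∷ x ∷ y ∷ z ∷ []))
    step : ∀ {M} G G′ N A B i j a b → + 2 * G + N ≈ A + (B + b) [ M ] → G′ ≈ G + i + j [ M ] →
      + 2 * j ≈ a [ M ] → - + 2 * i ≈ b [ M ] → + 2 * G′ + N ≈ A + a + B [ M ]
    step G G′ N A B i j a b h hG hj hi = linear (h ⊞ + 2 · hG ⊞ hj ⊞ (- + 1) · hi) (solve (G ∷ G′ ∷ N ∷ A ∷ B ∷ i ∷ j ∷ a ∷ b ∷ []))

  -- At m = n the terms `H n` of `H-halves` cancel and leave twice the claim.
  H-2n : H (2 ℕ.* n) ≈ + 0 [ P ]
  H-2n = halve P (H (2 ℕ.* n)) (H n) (+ n) (H-halves n 0 (ℕ.+-identityʳ n)) (≡⇒≈ (sym P≡1+2n))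
    where
    halve : ∀ P x y N → + 2 * x + y ≈ y + + 0 [ P ] → + 1 + + 2 * N ≈ P [ P ] → x ≈ + 0 [ P ]
    -- From 2N ≈ -1, the inverse of 2 is `- N`.
    halve P x y N h hP = linear ((- N) · h ⊞ x · hP ⊞ x · modulus P) (solve (P ∷ x ∷ y ∷ N ∷ []))

  -- The indices `suc m` and `suc k` exchanged in one step add up to p, so their inverses are
  -- opposite.
  H-reflect : ∀ m k → m ℕ.+ k ≡ 2 ℕ.* n → H m ≈ H k [ P ]
  H-reflect zero    k refl = ≈-sym H-2n
  H-reflect (suc m) k e =
    step (H m) (H k) (inv (suc m)) (inv (suc k)) (H-reflect m (suc k) (move e))
      (inv-scale (- + 1) k m (k<n-from {m} (move e)) (m<n-from e) (opposite P (+ m) (+ k) (≡⇒≈ (cong (λ x → + (1 ℕ.+ x)) e))))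
    where
    opposite : ∀ P x y → + 1 + (+ 1 + x + y) ≈ P [ P ] → + 1 + x ≈ - + 1 * (+ 1 + y) [ P ]
    opposite P x y h = linear (h ⊞ modulus P) (solve (P ∷ x ∷ y ∷ []))
    step : ∀ {M} A B a b → A ≈ B + b [ M ] → - + 1 * a ≈ b [ M ] → A + a ≈ B [ M ]
    step A B a b h hb = linear (h ⊞ (- + 1) · hb) (solve (A ∷ B ∷ a ∷ b ∷ []))

  private
    thirds-step : ∀ {M} G G′ S A B B′ C i₁ i₂ i₃ a b c → + 3 * G + + 2 * S ≈ A + B + (C + c) [ M ] →
      G′ ≈ G + i₁ + i₂ + i₃ [ M ] → B′ ≈ B + b [ M ] → + 3 * i₃ ≈ a [ M ] → + 3 * (i₁ + i₂) ≈ b - c [ M ] →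
      + 3 * G′ + + 2 * S ≈ A + a + B′ + C [ M ]
    thirds-step G G′ S A B B′ C i₁ i₂ i₃ a b c h hG hB h₃ h₁₂ =
      linear (h ⊞ + 3 · hG ⊞ (- + 1) · hB ⊞ h₃ ⊞ h₁₂) (solve (G ∷ G′ ∷ S ∷ A ∷ B ∷ B′ ∷ C ∷ i₁ ∷ i₂ ∷ i₃ ∷ a ∷ b ∷ c ∷ []))

    third-multiple : ∀ x → + 3 + + 3 * x ≡ + 3 * (+ 1 + x)
    third-multiple x = solve (x ∷ [])

  -- The multiples of 3 up to 3m contribute H m / 3; the indices i in the two other residue classes
  -- satisfy i + p = 3(s + j) and i - p = -3(s + 1 - j) respectively.
  H-thirds₁ : ∀ s → 2 ℕ.* n ≡ 3 ℕ.* s → ∀ m k → m ℕ.+ k ≡ s →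
    + 3 * H (3 ℕ.* m) + + 2 * H s ≈ H m + H (s ℕ.+ m) + H k [ P ]
  H-thirds₁ s 2n≡3s zero    k refl rewrite ℕ.+-identityʳ k = ≡⇒≈ (base (H k))
    where
    base : ∀ x → + 3 * + 0 + + 2 * x ≡ + 0 + x + x
    base x = solve (x ∷ [])
  H-thirds₁ s 2n≡3s (suc m) k e =
    thirds-step (H (3 ℕ.* m)) (H (3 ℕ.* suc m)) (H s) (H m) (H (s ℕ.+ m)) (H (s ℕ.+ suc m)) (H k) (inv (1 ℕ.+ 3 ℕ.* m)) (inv (2 ℕ.+ 3 ℕ.* m)) (inv (3 ℕ.+ 3 ℕ.* m))
      (inv (suc m)) (inv (suc (s ℕ.+ m))) (inv (suc k))
      (H-thirds₁ s 2n≡3s m (suc k) (move e)) (H-triple m) (≡⇒≈ (cong H (ℕ.+-suc s m)))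
      (inv-scale (+ 3) m (2 ℕ.+ 3 ℕ.* m) m<2n 3m+3≤2n (≡⇒≈ (trans (cong (λ x → + 3 + x) (ℤ.pos-* 3 m)) (third-multiple (+ m)))))
      (combine (inv (1 ℕ.+ 3 ℕ.* m)) (inv (2 ℕ.+ 3 ℕ.* m)) (inv (suc (s ℕ.+ m))) (inv (suc k))
        (inv-scale (- + 3) k (3 ℕ.* m) k<2n (ℕ.<⇒≤ (ℕ.<⇒≤ 3m+3≤2n))
          (≈-trans (≡⇒≈ (cong (λ x → + 1 + x) (ℤ.pos-* 3 m))) (below P (+ s) (+ m) (+ k) hs hP)))
        (inv-scale (+ 3) (s ℕ.+ m) (1 ℕ.+ 3 ℕ.* m) s+m<2n (ℕ.<⇒≤ 3m+3≤2n)
          (≈-trans (≡⇒≈ (cong (λ x → + 2 + x) (ℤ.pos-* 3 m))) (above P (+ s) (+ m) hP))))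
    where
    s≤2n : s ≤ 2 ℕ.* n
    s≤2n = ℕ.≤-trans (ℕ.m≤m+n s _) (ℕ.≤-reflexive (sym 2n≡3s))
    m<s : m < s
    m<s = m<n-from e
    m<2n : m < 2 ℕ.* n
    m<2n = ℕ.≤-trans m<s s≤2n
    k<2n : k < 2 ℕ.* n
    k<2n = ℕ.≤-trans (k<n-from {m} (move e)) s≤2n
    3m+3≤2n : 3 ℕ.+ 3 ℕ.* m ≤ 2 ℕ.* n
    3m+3≤2n = ℕ.≤-trans (ℕ.≤-reflexive (sym (ℕ.*-suc 3 m))) (ℕ.≤-trans (ℕ.*-monoʳ-≤ 3 m<s) (ℕ.≤-reflexive (sym 2n≡3s)))
    s+m<2n : s ℕ.+ m < 2 ℕ.* n
    s+m<2n = ℕ.≤-trans (ℕ.+-monoʳ-< s m<s) (ℕ.≤-trans (ℕ.+-monoʳ-≤ s (ℕ.m≤m+n s _)) (ℕ.≤-reflexive (sym 2n≡3s)))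
    hs : + 1 + + m + + k ≈ + s [ P ]
    hs = ≡⇒≈ (cong +_ e)
    hP : + 1 + + 3 * + s ≈ P [ P ]
    hP = ≡⇒≈ (trans (cong (λ x → + 1 + x) (sym (ℤ.pos-* 3 s))) (cong (λ x → + suc x) (sym 2n≡3s)))
    below : ∀ P s m k → + 1 + m + k ≈ s [ P ] → + 1 + + 3 * s ≈ P [ P ] → + 1 + + 3 * m ≈ - + 3 * (+ 1 + k) [ P ]
    below P s m k hs h = linear (+ 3 · hs ⊞ h ⊞ modulus P) (solve (P ∷ s ∷ m ∷ k ∷ []))
    above : ∀ P s m → + 1 + + 3 * s ≈ P [ P ] → + 2 + + 3 * m ≈ + 3 * (+ 1 + (s + m)) [ P ]
    above P s m h = linear ((- + 1) · h ⊞ (- + 1) · modulus P) (solve (P ∷ s ∷ m ∷ []))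
    combine : ∀ {M} i₁ i₂ b c → - + 3 * i₁ ≈ c [ M ] → + 3 * i₂ ≈ b [ M ] → + 3 * (i₁ + i₂) ≈ b - c [ M ]
    combine i₁ i₂ b c h₁ h₂ = linear ((- + 1) · h₁ ⊞ h₂) (solve (i₁ ∷ i₂ ∷ b ∷ c ∷ []))

  -- For p = 3s + 2 the two classes swap roles compared with `H-thirds₁`: 3m + 1 is translated
  -- upwards to 3(s + m + 1), and 3m + 2 downwards to -3(k + 1).
  H-thirds₂ : ∀ s → 2 ℕ.* n ≡ suc (3 ℕ.* s) → ∀ m k → m ℕ.+ k ≡ s →
    + 3 * H (3 ℕ.* m) + + 2 * H s ≈ H m + H (s ℕ.+ m) + H k [ P ]
  H-thirds₂ s 2n≡3s+1 zero    k refl rewrite ℕ.+-identityʳ k = ≡⇒≈ (base (H k))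
    where
    base : ∀ x → + 3 * + 0 + + 2 * x ≡ + 0 + x + x
    base x = solve (x ∷ [])
  H-thirds₂ s 2n≡3s+1 (suc m) k e =
    thirds-step (H (3 ℕ.* m)) (H (3 ℕ.* suc m)) (H s) (H m) (H (s ℕ.+ m)) (H (s ℕ.+ suc m)) (H k) (inv (1 ℕ.+ 3 ℕ.* m)) (inv (2 ℕ.+ 3 ℕ.* m)) (inv (3 ℕ.+ 3 ℕ.* m))
      (inv (suc m)) (inv (suc (s ℕ.+ m))) (inv (suc k))
      (H-thirds₂ s 2n≡3s+1 m (suc k) (move e)) (H-triple m) (≡⇒≈ (cong H (ℕ.+-suc s m)))
      (inv-scale (+ 3) m (2 ℕ.+ 3 ℕ.* m) m<2n 3m+3≤2n (≡⇒≈ (trans (cong (λ x → + 3 + x) (ℤ.pos-* 3 m)) (third-multiple (+ m)))))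
      (combine (inv (1 ℕ.+ 3 ℕ.* m)) (inv (2 ℕ.+ 3 ℕ.* m)) (inv (suc (s ℕ.+ m))) (inv (suc k))
        (inv-scale (- + 3) k (1 ℕ.+ 3 ℕ.* m) k<2n (ℕ.<⇒≤ 3m+3≤2n)
          (≈-trans (≡⇒≈ (cong (λ x → + 2 + x) (ℤ.pos-* 3 m))) (below P (+ s) (+ m) (+ k) hs hP)))
        (inv-scale (+ 3) (s ℕ.+ m) (3 ℕ.* m) s+m<2n (ℕ.<⇒≤ (ℕ.<⇒≤ 3m+3≤2n))
          (≈-trans (≡⇒≈ (cong (λ x → + 1 + x) (ℤ.pos-* 3 m))) (above P (+ s) (+ m) hP))))
    where
    3s≤2n : 3 ℕ.* s ≤ 2 ℕ.* n
    3s≤2n = ℕ.≤-trans (ℕ.n≤1+n _) (ℕ.≤-reflexive (sym 2n≡3s+1))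
    s≤2n : s ≤ 2 ℕ.* n
    s≤2n = ℕ.≤-trans (ℕ.m≤m+n s _) 3s≤2n
    m<s : m < s
    m<s = m<n-from e
    m<2n : m < 2 ℕ.* n
    m<2n = ℕ.≤-trans m<s s≤2n
    k<2n : k < 2 ℕ.* n
    k<2n = ℕ.≤-trans (k<n-from {m} (move e)) s≤2n
    3m+3≤2n : 3 ℕ.+ 3 ℕ.* m ≤ 2 ℕ.* n
    3m+3≤2n = ℕ.≤-trans (ℕ.≤-reflexive (sym (ℕ.*-suc 3 m))) (ℕ.≤-trans (ℕ.*-monoʳ-≤ 3 m<s) 3s≤2n)
    s+m<2n : s ℕ.+ m < 2 ℕ.* n
    s+m<2n = ℕ.≤-trans (ℕ.+-monoʳ-< s m<s) (ℕ.≤-trans (ℕ.+-monoʳ-≤ s (ℕ.m≤m+n s _)) 3s≤2n)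
    hs : + 1 + + m + + k ≈ + s [ P ]
    hs = ≡⇒≈ (cong +_ e)
    hP : + 2 + + 3 * + s ≈ P [ P ]
    hP = ≡⇒≈ (trans (cong (λ x → + 2 + x) (sym (ℤ.pos-* 3 s))) (cong (λ x → + suc x) (sym 2n≡3s+1)))
    below : ∀ P s m k → + 1 + m + k ≈ s [ P ] → + 2 + + 3 * s ≈ P [ P ] → + 2 + + 3 * m ≈ - + 3 * (+ 1 + k) [ P ]
    below P s m k hs h = linear (+ 3 · hs ⊞ h ⊞ modulus P) (solve (P ∷ s ∷ m ∷ k ∷ []))
    above : ∀ P s m → + 2 + + 3 * s ≈ P [ P ] → + 1 + + 3 * m ≈ + 3 * (+ 1 + (s + m)) [ P ]
    above P s m h = linear ((- + 1) · h ⊞ (- + 1) · modulus P) (solve (P ∷ s ∷ m ∷ []))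
    combine : ∀ {M} i₁ i₂ b c → - + 3 * i₂ ≈ c [ M ] → + 3 * i₁ ≈ b [ M ] → + 3 * (i₁ + i₂) ≈ b - c [ M ]
    combine i₁ i₂ b c h₂ h₁ = linear ((- + 1) · h₂ ⊞ h₁) (solve (i₁ ∷ i₂ ∷ b ∷ c ∷ []))

  -- Row p of Pascal's triangle and the value of p D(n).

  -- c k is the binomial coefficient (p choose k), so that T p = 2^p.
  module _
    (c : ℕ → ℤ) (c-zero : c 0 ≡ + 1) (c-suc : ∀ k → (+ 1 + + k) * c (suc k) ≈ (P - + k) * c k [ M ])
    where

    T : ℕ → ℤ
    T = partial-sum c

    alternating : ℕ → ℤ
    alternating zero    = + 1
    alternating (suc k) = - alternating k

    alternating-even : ∀ k → alternating (2 ℕ.* k) ≡ + 1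
    alternating-even zero    = refl
    alternating-even (suc k) = trans (cong alternating (ℕ.*-suc 2 k)) (trans (ℤ.neg-involutive _) (alternating-even k))

    -- Here binom(p, k+1) = p/(k+1) binom(p-1, k), and binom(p-1, k) ≈ (-1)^k modulo p.
    c-suc≈ : ∀ k → k < 2 ℕ.* n → c (suc k) ≈ P * (alternating k * inv (suc k)) [ M ]
    c-suc≈ zero    0<2n = base P (c 0) (c 1) (inv 1) (≡⇒≈ c-zero) (c-suc 0) (inverse 0 0<2n)
      where
      base : ∀ P c c′ i → c ≈ + 1 [ P * P ] → (+ 1 + + 0) * c′ ≈ (P - + 0) * c [ P * P ] → i * + 1 ≈ + 1 [ P * P ] →
        c′ ≈ P * (+ 1 * i) [ P * P ]
      base P c c′ i hc h hi = linear (h ⊞ P · hc ⊞ (- P) · hi) (solve (P ∷ c ∷ c′ ∷ i ∷ []))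
    c-suc≈ (suc k) 1+k<2n =
      step P (+ k) (alternating k) (c (suc k)) (c (suc (suc k))) (inv (suc k)) (inv (suc (suc k)))
        (c-suc≈ k (ℕ.<⇒≤ 1+k<2n)) (c-suc (suc k)) (inverse k (ℕ.<⇒≤ 1+k<2n)) (inverse (suc k) 1+k<2n)
      where
      step : ∀ P K s c c′ i i′ → c ≈ P * (s * i) [ P * P ] → (+ 1 + (+ 1 + K)) * c′ ≈ (P - (+ 1 + K)) * c [ P * P ] →
        i * (+ 1 + K) ≈ + 1 [ P * P ] → i′ * (+ 2 + K) ≈ + 1 [ P * P ] → c′ ≈ P * (- s * i′) [ P * P ]
      step P K s c c′ i i′ hc h hi hi′ =
        linear ((- c′) · hi′ ⊞ i′ · h ⊞ (i′ * (P - (+ 1 + K))) · hc ⊞ (- (P * s * i′)) · hi ⊞ (i′ * s * i) · modulus (P * P))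
          (solve (P ∷ K ∷ s ∷ c ∷ c′ ∷ i ∷ i′ ∷ []))

    -- Consecutive entries pair up to p (1/(2i-1) - 1/(2i)), which is half of p times an increment
    -- of `D`.
    T-even : ∀ j → j ≤ n → + 2 * T (2 ℕ.* j) ≈ + 2 + P * D j [ M ]
    T-even zero    _   = base P (c 0) (≡⇒≈ c-zero)
      where
      base : ∀ {M} P c → c ≈ + 1 [ M ] → + 2 * c ≈ + 2 + P * + 0 [ M ]
      base P c h = linear (+ 2 · h) (solve (P ∷ c ∷ []))
    T-even (suc j) j<n =
      step P (D j) (T (2 ℕ.* j)) (T (2 ℕ.* suc j)) (c (1 ℕ.+ 2 ℕ.* j)) (c (2 ℕ.+ 2 ℕ.* j))
        (inv (1 ℕ.+ 2 ℕ.* j)) (inv (2 ℕ.+ 2 ℕ.* j)) (inv (suc j)) (alternating (2 ℕ.* j))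
        (T-even j (ℕ.<⇒≤ j<n)) (≡⇒≈ (cong T (ℕ.*-suc 2 j))) (≡⇒≈ (alternating-even j))
        (c-suc≈ (2 ℕ.* j) (ℕ.<⇒≤ 2j+2≤2n)) (c-suc≈ (1 ℕ.+ 2 ℕ.* j) 2j+2≤2n)
        (P· inv-scale (+ 2) j (1 ℕ.+ 2 ℕ.* j) (ℕ.≤-trans j<n n≤2n) 2j+2≤2n
          (≡⇒≈ (trans (cong (λ x → + 2 + x) (ℤ.pos-* 2 j)) (double (+ j)))))
      where
      2j+2≤2n : 2 ℕ.+ 2 ℕ.* j ≤ 2 ℕ.* n
      2j+2≤2n = ℕ.≤-trans (ℕ.≤-reflexive (sym (ℕ.*-suc 2 j))) (ℕ.*-monoʳ-≤ 2 j<n)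
      double : ∀ x → + 2 + + 2 * x ≡ + 2 * (+ 1 + x)
      double x = solve (x ∷ [])
      step : ∀ {M} P D T T′ c c′ i i′ j s → + 2 * T ≈ + 2 + P * D [ M ] → T′ ≈ T + c + c′ [ M ] → s ≈ + 1 [ M ] →
        c ≈ P * (s * i) [ M ] → c′ ≈ P * (- s * i′) [ M ] → P * (+ 2 * i′) ≈ P * j [ M ] →
        + 2 * T′ ≈ + 2 + P * (D + (+ 2 * i - j)) [ M ]
      step P D T T′ c c′ i i′ j s h hT hs hc hc′ hj =
        linear (h ⊞ + 2 · hT ⊞ + 2 · hc ⊞ + 2 · hc′ ⊞ (+ 2 * P * (i - i′)) · hs ⊞ (- + 1) · hj)
          (solve (P ∷ D ∷ T ∷ T′ ∷ c ∷ c′ ∷ i ∷ i′ ∷ j ∷ s ∷ []))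

    PD≈2T-4 : c (suc (2 ℕ.* n)) ≡ + 1 → P * D n ≈ + 2 * T (suc (2 ℕ.* n)) - + 4 [ M ]
    PD≈2T-4 c-last = alg P (D n) (T (2 ℕ.* n)) (c (suc (2 ℕ.* n))) (T-even n ℕ.≤-refl) (≡⇒≈ c-last)
      where
      alg : ∀ {M} P D T c → + 2 * T ≈ + 2 + P * D [ M ] → c ≈ + 1 [ M ] → P * D ≈ + 2 * (T + c) - + 4 [ M ]
      alg P D T c h hc = linear ((- + 1) · h ⊞ (- + 2) · hc) (solve (P ∷ D ∷ T ∷ c ∷ []))

  -- With d = e + 1 the hypothesis on `a` reads (da + 1)(da + d - 1) ≈ 0, so it admits both -1/d and
  -- its mirror image -1 + 1/d. It gives -d² (a-k)(a+k+1) ≈ (dk + 1)(dk + e), which matches the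
  -- ratio of `u` with that of `β`.
  u-scaled : ∀ a (c e : ℕ) → + suc e * + suc e * (a * (a + + 1)) ≈ - + e [ M ] → (β : ℕ → ℕ) → β 0 ≡ 1 →
    (∀ k → β (suc k) ℕ.* (suc k ℕ.* suc k) ≡ c ℕ.* ((suc e ℕ.* k ℕ.+ 1) ℕ.* (suc e ℕ.* k ℕ.+ e)) ℕ.* β k) →
    ∀ k → k ≤ n → + β k ≈ u a k * + ((c ℕ.* (suc e ℕ.* suc e)) ℕ.^ k) [ M ]
  u-scaled a c e ha β β-zero β-suc zero    _   = ≡⇒≈ (cong +_ β-zero)
  u-scaled a c e ha β β-zero β-suc (suc k) k<n =
    step a (+ e) (+ c) (+ k) (inv (suc k)) (u a k) (+ β k) (+ β (suc k)) (+ (B ℕ.^ k)) (+ (B ℕ.^ suc k)) ha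
      (u-scaled a c e ha β β-zero β-suc k (ℕ.<⇒≤ k<n))
      (≡⇒≈ (trans (sym lhs) (trans (cong +_ (β-suc k)) rhs))) (≡⇒≈ power) (inverse-≤n k k<n)
    where
    d B : ℕ
    d = suc e
    B = c ℕ.* (d ℕ.* d)
    lhs : + (β (suc k) ℕ.* (suc k ℕ.* suc k)) ≡ + β (suc k) * (+ suc k * + suc k)
    lhs = trans (ℤ.pos-* (β (suc k)) _) (cong (+ β (suc k) *_) (ℤ.pos-* (suc k) (suc k)))
    rhs : + (c ℕ.* ((d ℕ.* k ℕ.+ 1) ℕ.* (d ℕ.* k ℕ.+ e)) ℕ.* β k) ≡ + c * ((+ d * + k + + 1) * (+ d * + k + + e)) * + β k
    rhs = trans (ℤ.pos-* (c ℕ.* _) (β k)) (cong (_* + β k) (trans (ℤ.pos-* c _) (cong (+ c *_)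
      (trans (ℤ.pos-* (d ℕ.* k ℕ.+ 1) _) (cong (λ x → (x + + 1) * (x + + e)) (ℤ.pos-* d k))))))
    power : + (B ℕ.^ suc k) ≡ + c * (+ d * + d) * + (B ℕ.^ k)
    power = trans (ℤ.pos-* B _) (cong (_* + (B ℕ.^ k)) (trans (ℤ.pos-* c _) (cong (+ c *_) (ℤ.pos-* d d))))
    step : ∀ {M} a e c K i u β β′ B B′ → (+ 1 + e) * (+ 1 + e) * (a * (a + + 1)) ≈ - e [ M ] → β ≈ u * B [ M ] →
      β′ * ((+ 1 + K) * (+ 1 + K)) ≈ c * (((+ 1 + e) * K + + 1) * ((+ 1 + e) * K + e)) * β [ M ] →
      B′ ≈ c * ((+ 1 + e) * (+ 1 + e)) * B [ M ] → i * (+ 1 + K) ≈ + 1 [ M ] →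
      β′ ≈ - ((a - K) * (a + K + + 1)) * (i * i) * u * B′ [ M ]
    step a e c K i u β β′ B B′ ha h hβ hB hi =
      linear ((- (β′ * ((+ 1 + K) * i + + 1))) · hi ⊞ (i * i) · hβ
          ⊞ (i * i * (c * (((+ 1 + e) * K + + 1) * ((+ 1 + e) * K + e)))) · h
          ⊞ ((a - K) * (a + K + + 1) * (i * i) * u) · hB
          ⊞ (c * B * (i * i) * u) · ha)
        (solve (a ∷ e ∷ c ∷ K ∷ i ∷ u ∷ β ∷ β′ ∷ B ∷ B′ ∷ []))

  -- D(r) modulo p at the special points.

  private
    D-from-H : ∀ {r G} → r ≤ n → H (2 ℕ.* r) ≡ G → D r ≈ + 2 * G - + 2 * H r [ P ]
    D-from-H r≤n refl = D≈H _ r≤n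

  -- `H-halves` at m = k = r gives 2 H r ≈ 3 H n, so D r ≈ -H n, while D n ≈ -2 H n.
  D-quarter₁ : ∀ r → 2 ℕ.* r ≡ n → D n ≈ + 2 * D r [ P ]
  D-quarter₁ r e =
    alg (D n) (D r) (H (2 ℕ.* n)) (H n) (H r) (D≈H n ℕ.≤-refl)
      (D-from-H (ℕ.≤-trans (ℕ.m≤m+n r _) (ℕ.≤-reflexive e)) (cong H e))
      H-2n (≈-trans (≡⇒≈ (cong (λ x → + 2 * x + H n) (cong H (sym e)))) (H-halves r r (trans (twice r) e)))
    where
    twice : ∀ r → r ℕ.+ r ≡ 2 ℕ.* r
    twice = ℕ-Solver.solve-∀
    alg : ∀ {M} D D′ Z N R → D ≈ + 2 * Z - + 2 * N [ M ] → D′ ≈ + 2 * N - + 2 * R [ M ] → Z ≈ + 0 [ M ] →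
      + 2 * N + N ≈ R + R [ M ] → D ≈ + 2 * D′ [ M ]
    alg D D′ Z N R h h′ hZ hN = linear (h ⊞ (- + 2) · h′ ⊞ + 2 · hZ ⊞ (- + 2) · hN) (solve (D ∷ D′ ∷ Z ∷ N ∷ R ∷ []))

  -- For odd n the halves are r and r + 1. The unpaired 1/(r+1) equals -2/(2r+1), because p = 4r +
  -- 3.
  D-quarter₂ : ∀ r → suc (2 ℕ.* r) ≡ n → D n ≈ + 2 * D r + + 4 * inv (suc (2 ℕ.* r)) [ P ]
  D-quarter₂ r e =
    alg (D n) (D r) (H (2 ℕ.* n)) (H n) (H r) (H (2 ℕ.* r)) (inv (suc (2 ℕ.* r))) (inv (suc r))
      (D≈H n ℕ.≤-refl) (D≈H r (ℕ.<⇒≤ r<n)) H-2n (H-halves r (suc r) (trans (twice r) e))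
      (inv-scale (- + 2) r (2 ℕ.* r) (ℕ.≤-trans r<n n≤2n) (ℕ.≤-trans (ℕ.≤-reflexive e) n≤2n)
        (≈-trans (≡⇒≈ (cong (λ x → + 1 + x) (ℤ.pos-* 2 r))) (negate P (+ r) (≡⇒≈ P≡))))
    where
    r<n : r < n
    r<n = ℕ.≤-trans (s≤s (ℕ.m≤m+n r _)) (ℕ.≤-reflexive e)
    twice : ∀ r → r ℕ.+ suc r ≡ suc (2 ℕ.* r)
    twice = ℕ-Solver.solve-∀
    P≡ : + 3 + + 4 * + r ≡ P
    P≡ = trans (cong (λ x → + 3 + x) (sym (ℤ.pos-* 4 r))) (cong +_ (trans (expand r) (cong (λ x → suc (2 ℕ.* x)) e)))
      where
      expand : ∀ r → 3 ℕ.+ 4 ℕ.* r ≡ suc (2 ℕ.* suc (2 ℕ.* r))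
      expand = ℕ-Solver.solve-∀
    negate : ∀ P r → + 3 + + 4 * r ≈ P [ P ] → + 1 + + 2 * r ≈ - + 2 * (+ 1 + r) [ P ]
    negate P r h = linear (h ⊞ modulus P) (solve (P ∷ r ∷ []))
    alg : ∀ {M} D D′ Z N R G j i → D ≈ + 2 * Z - + 2 * N [ M ] → D′ ≈ + 2 * G - + 2 * R [ M ] → Z ≈ + 0 [ M ] →
      + 2 * G + N ≈ R + (R + i) [ M ] → - + 2 * j ≈ i [ M ] → D ≈ + 2 * D′ + + 4 * j [ M ]
    alg D D′ Z N R G j i h h′ hZ hN hj =
      linear (h ⊞ (- + 2) · h′ ⊞ + 2 · hZ ⊞ (- + 2) · hN ⊞ + 2 · hj) (solve (D ∷ D′ ∷ Z ∷ N ∷ R ∷ G ∷ j ∷ i ∷ []))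

  -- Reflection identifies H (2r) with H r, as 2r + r = p - 1.
  D-third₁ : ∀ r → r ≤ n → 3 ℕ.* r ≡ 2 ℕ.* n → D r ≈ + 0 [ P ]
  D-third₁ r r≤n e =
    alg (D r) (H (2 ℕ.* r)) (H r) (D≈H r r≤n) (H-reflect (2 ℕ.* r) r (trans (thrice r) e))
    where
    thrice : ∀ r → 2 ℕ.* r ℕ.+ r ≡ 3 ℕ.* r
    thrice = ℕ-Solver.solve-∀
    alg : ∀ {M} D G R → D ≈ + 2 * G - + 2 * R [ M ] → G ≈ R [ M ] → D ≈ + 0 [ M ]
    alg D G R h hG = linear (h ⊞ + 2 · hG) (solve (D ∷ G ∷ R ∷ []))

  -- Now (2r + 1) + r = p - 1, so reflection applies to H (2r + 1), one term beyond H (2r).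
  D-third₂ : ∀ r → r ≤ n → suc (3 ℕ.* r) ≡ 2 ℕ.* n → D r ≈ - + 2 * inv (suc (2 ℕ.* r)) [ P ]
  D-third₂ r r≤n e =
    alg (D r) (H (2 ℕ.* r)) (H r) (inv (suc (2 ℕ.* r))) (D≈H r r≤n) (H-reflect (suc (2 ℕ.* r)) r (trans (thrice r) e))
    where
    thrice : ∀ r → suc (2 ℕ.* r) ℕ.+ r ≡ suc (3 ℕ.* r)
    thrice = ℕ-Solver.solve-∀
    alg : ∀ {M} D G R j → D ≈ + 2 * G - + 2 * R [ M ] → G + j ≈ R [ M ] → D ≈ - + 2 * j [ M ]
    alg D G R j h hG = linear (h ⊞ + 2 · hG) (solve (D ∷ G ∷ R ∷ j ∷ []))

  -- `H-thirds₁` with s = 2r and m = k = r: two of its sums are H n, leaving 2 H (2r) - 2 H r ≈ -2 H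
  -- n.
  D-sixth₁ : ∀ r → 3 ℕ.* r ≡ n → D r ≈ D n [ P ]
  D-sixth₁ r e =
    alg (D r) (D n) (H (2 ℕ.* n)) (H n) (H (3 ℕ.* r)) (H (2 ℕ.* r ℕ.+ r)) (H r) (H (2 ℕ.* r))
      (D≈H r (ℕ.≤-trans (ℕ.m≤m+n r _) (ℕ.≤-reflexive e))) (D≈H n ℕ.≤-refl) H-2n
      (≡⇒≈ (cong H e)) (≡⇒≈ (cong H (trans (thrice r) e)))
      (H-thirds₁ (2 ℕ.* r) (trans (cong (2 ℕ.*_) (sym e)) (swap r)) r r (twice r))
    where
    twice : ∀ r → r ℕ.+ r ≡ 2 ℕ.* r
    twice = ℕ-Solver.solve-∀
    thrice : ∀ r → 2 ℕ.* r ℕ.+ r ≡ 3 ℕ.* r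
    thrice = ℕ-Solver.solve-∀
    swap : ∀ r → 2 ℕ.* (3 ℕ.* r) ≡ 3 ℕ.* (2 ℕ.* r)
    swap = ℕ-Solver.solve-∀
    alg : ∀ {M} D D′ Z N X Y R G → D ≈ + 2 * G - + 2 * R [ M ] → D′ ≈ + 2 * Z - + 2 * N [ M ] → Z ≈ + 0 [ M ] →
      X ≈ N [ M ] → Y ≈ N [ M ] → + 3 * X + + 2 * G ≈ R + Y + R [ M ] → D ≈ D′ [ M ]
    alg D D′ Z N X Y R G h h′ hZ hX hY hH =
      linear (h ⊞ (- + 1) · h′ ⊞ (- + 2) · hZ ⊞ (- + 3) · hX ⊞ hY ⊞ hH) (solve (D ∷ D′ ∷ Z ∷ N ∷ X ∷ Y ∷ R ∷ G ∷ []))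

  -- `H-thirds₂` with s = 2r + 1, m = r + 1 and k = r. The sum H (3m) overshoots n by one term, and
  -- 3/(n+1) = 1/(r+1) absorbs the last term of H (r + 1).
  D-sixth₂ : ∀ r → 2 ℕ.+ 3 ℕ.* r ≡ n → D r ≈ D n - + 2 * inv (suc (2 ℕ.* r)) [ P ]
  D-sixth₂ r e =
    alg (D r) (D n) (H (2 ℕ.* n)) (H n) (H (3 ℕ.* suc r)) (H (suc (2 ℕ.* r) ℕ.+ suc r)) (H r) (H (2 ℕ.* r))
      (inv (suc (2 ℕ.* r))) (inv (suc n)) (inv (suc r))
      (D≈H r (ℕ.≤-trans r≤3r+2 (ℕ.≤-reflexive e))) (D≈H n ℕ.≤-refl) H-2n
      (≡⇒≈ (cong H (trans (expand r) (cong suc e)))) (≡⇒≈ (cong H (trans (thrice r) e)))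
      (H-thirds₂ (suc (2 ℕ.* r)) (trans (cong (2 ℕ.*_) (sym e)) (swap r)) (suc r) r (twice r))
      (inv-scale (+ 3) r n r<2n n<2n
        (≡⇒≈ (trans (cong +_ (trans (sym (cong suc e)) (sym (expand r)))) (ℤ.pos-* 3 (suc r)))))
    where
    r≤3r+2 : r ≤ 2 ℕ.+ 3 ℕ.* r
    r≤3r+2 = ℕ.≤-trans (ℕ.m≤m+n r _) (ℕ.m≤n+m (3 ℕ.* r) 2)
    r<2n : r < 2 ℕ.* n
    r<2n = ℕ.≤-trans (s≤s (ℕ.≤-trans (ℕ.m≤m+n r _) (ℕ.n≤1+n (3 ℕ.* r)))) (ℕ.≤-trans (ℕ.≤-reflexive e) n≤2n)
    n<2n : n < 2 ℕ.* n
    n<2n = ℕ.m<m+n n (ℕ.≤-trans (ℕ.≤-trans (s≤s z≤n) (ℕ.≤-reflexive e)) (ℕ.m≤m+n n 0))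
    expand : ∀ r → 3 ℕ.* suc r ≡ 3 ℕ.+ 3 ℕ.* r
    expand = ℕ.*-suc 3
    twice : ∀ r → suc r ℕ.+ r ≡ suc (2 ℕ.* r)
    twice = ℕ-Solver.solve-∀
    thrice : ∀ r → suc (2 ℕ.* r) ℕ.+ suc r ≡ 2 ℕ.+ 3 ℕ.* r
    thrice = ℕ-Solver.solve-∀
    swap : ∀ r → 2 ℕ.* (2 ℕ.+ 3 ℕ.* r) ≡ suc (3 ℕ.* suc (2 ℕ.* r))
    swap = ℕ-Solver.solve-∀
    alg : ∀ {M} D D′ Z N X Y R G j x y → D ≈ + 2 * G - + 2 * R [ M ] → D′ ≈ + 2 * Z - + 2 * N [ M ] → Z ≈ + 0 [ M ] →
      X ≈ N + x [ M ] → Y ≈ N [ M ] → + 3 * X + + 2 * (G + j) ≈ R + y + Y + R [ M ] → + 3 * x ≈ y [ M ] →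
      D ≈ D′ - + 2 * j [ M ]
    alg D D′ Z N X Y R G j x y h h′ hZ hX hY hH hx =
      linear (h ⊞ (- + 1) · h′ ⊞ (- + 2) · hZ ⊞ (- + 3) · hX ⊞ hY ⊞ hH ⊞ (- + 1) · hx)
        (solve (D ∷ D′ ∷ Z ∷ N ∷ X ∷ Y ∷ R ∷ G ∷ j ∷ x ∷ y ∷ []))

  -- Values of F at r + pt for denominators 4, 3 and 6.

  P≡1+dr : ∀ d r → d ℕ.* r ≡ 2 ℕ.* n → + 1 + + d * + r ≡ P
  P≡1+dr d r e = trans (cong (λ x → + 1 + x) (sym (ℤ.pos-* d r))) (cong (λ x → + suc x) e)

  P≡k+dr : ∀ k d r → k ℕ.+ d ℕ.* r ≡ suc (2 ℕ.* n) → + k + + d * + r ≡ P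
  P≡k+dr k d r e = trans (cong (λ x → + k + x) (sym (ℤ.pos-* d r))) (cong +_ e)

  -- Modulo p² the argument is a ≈ -e/d, so d² a (a+1) ≈ -e (d-e). For e = 1 and for e = d - 1 this
  -- is -(d-1), as `u-scaled` demands.
  shifted-argument : ∀ d e f R t → d * t ≈ - + 1 [ M ] → e + d * R ≡ P → e * (d - e) ≡ f →
    d * d * ((R + P * t) * (R + P * t + + 1)) ≈ - f [ M ]
  shifted-argument d e f R t ht hP he = alg P d e f R t ht (≡⇒≈ hP) (≡⇒≈ he)
    where
    alg : ∀ {M} P d e f R t → d * t ≈ - + 1 [ M ] → e + d * R ≈ P [ M ] → e * (d - e) ≈ f [ M ] →
      d * d * ((R + P * t) * (R + P * t + + 1)) ≈ - f [ M ]
    alg P d e f R t ht hP he =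
      linear ((d * (R + P * t) - e + d) · hP ⊞ ((d * (R + P * t) - e + d) * P) · ht ⊞ (- + 1) · he)
        (solve (P ∷ d ∷ e ∷ f ∷ R ∷ t ∷ []))

  F-quarter₁ : ∀ r t → 2 ℕ.* r ≡ n → + 4 * t ≈ - + 1 [ M ] → F (+ r + P * t) n ≈ - + suc n [ M ]
  F-quarter₁ r t e ht =
    alg P t (+ r) (+ n) (D n) (D r) (F (+ r + P * t) n)
      (F-value t r (ℕ.≤-trans (ℕ.m≤m+n r _) (ℕ.≤-reflexive e))) (P· D-quarter₁ r e)
      (≡⇒≈ (trans (sym (ℤ.pos-* 2 r)) (cong +_ e)))
    where
    alg : ∀ {M} P t R N D D′ F → F ≈ - (+ 1 + + 2 * R) * (+ 1 + P * t * (D - + 2 * D′)) [ M ] →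
      P * D ≈ P * (+ 2 * D′) [ M ] → + 2 * R ≈ N [ M ] → F ≈ - (+ 1 + N) [ M ]
    alg P t R N D D′ F hF hD hN =
      linear (hF ⊞ (- ((+ 1 + + 2 * R) * t)) · hD ⊞ (- + 1) · hN) (solve (P ∷ t ∷ R ∷ N ∷ D ∷ D′ ∷ F ∷ []))

  -- The correction is 4/(2r+1), so the value is -(2r+1) - 4pt = -n + p = n + 1.
  F-quarter₂ : ∀ r t → suc (2 ℕ.* r) ≡ n → + 4 * t ≈ - + 1 [ M ] → F (+ r + P * t) n ≈ + suc n [ M ]
  F-quarter₂ r t e ht =
    alg P t (+ r) (+ n) (D n) (D r) (F (+ r + P * t) n) (inv (suc (2 ℕ.* r)))
      (F-value t r (ℕ.<⇒≤ r<n)) (P· D-quarter₂ r e)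
      (≡⇒≈ (trans (cong (λ x → + 1 + x) (sym (ℤ.pos-* 2 r))) (cong +_ e)))
      (≡⇒≈ (sym P≡1+2n)) (inverse-odd r r<n) ht
    where
    r<n : r < n
    r<n = ℕ.≤-trans (s≤s (ℕ.m≤m+n r _)) (ℕ.≤-reflexive e)
    alg : ∀ {M} P t R N D D′ F j → F ≈ - (+ 1 + + 2 * R) * (+ 1 + P * t * (D - + 2 * D′)) [ M ] →
      P * D ≈ P * (+ 2 * D′ + + 4 * j) [ M ] → + 1 + + 2 * R ≈ N [ M ] → + 1 + + 2 * N ≈ P [ M ] →
      j * (+ 1 + + 2 * R) ≈ + 1 [ M ] → + 4 * t ≈ - + 1 [ M ] → F ≈ + 1 + N [ M ]
    alg P t R N D D′ F j hF hD hN hP hj ht =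
      linear (hF ⊞ (- ((+ 1 + + 2 * R) * t)) · hD ⊞ (- + 1) · hN ⊞ (- + 1) · hP ⊞ (- (+ 4 * t * P)) · hj ⊞ (- P) · ht)
        (solve (P ∷ t ∷ R ∷ N ∷ D ∷ D′ ∷ F ∷ j ∷ []))

  module _ (E : ℤ) (PD≈2E-4 : P * D n ≈ + 2 * E - + 4 [ M ]) where

    -- From 3(2r+1) = 2p + 1 and D r ≈ 0 one gets 9F ≈ -(2p+1)(3 - p D n). The 7 is 3 plus the 4 of
    -- `PD≈2E-4`.
    F-third₁ : ∀ r t → r ≤ n → 3 ℕ.* r ≡ 2 ℕ.* n → + 3 * t ≈ - + 1 [ M ] →
      + 9 * F (+ r + P * t) n ≈ + 2 * E - (+ 7 + + 6 * P) [ M ]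
    F-third₁ r t r≤n e ht =
      alg P t E (+ r) (D n) (D r) (F (+ r + P * t) n)
        (F-value t r r≤n) (P· D-third₁ r r≤n e) (≡⇒≈ (P≡1+dr 3 r e)) ht PD≈2E-4
      where
      alg : ∀ P t E R D D′ F → F ≈ - (+ 1 + + 2 * R) * (+ 1 + P * t * (D - + 2 * D′)) [ P * P ] →
        P * D′ ≈ P * + 0 [ P * P ] → + 1 + + 3 * R ≈ P [ P * P ] → + 3 * t ≈ - + 1 [ P * P ] →
        P * D ≈ + 2 * E - + 4 [ P * P ] → + 9 * F ≈ + 2 * E - (+ 7 + + 6 * P) [ P * P ]
      alg P t E R D D′ F hF hD hR ht hE =
        linear (+ 9 · hF ⊞ (- + 6 * (+ 1 + P * t * (D - + 2 * D′))) · hR ⊞ (- ((+ 2 * P + + 1) * P * (D - + 2 * D′))) · ht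
            ⊞ hE ⊞ (- + 2) · hD ⊞ (+ 2 * (D - + 2 * D′)) · modulus (P * P))
          (solve (P ∷ t ∷ E ∷ R ∷ D ∷ D′ ∷ F ∷ []))

    -- Here 3(2r+1) = 2p - 1, so 1/(2r+1) ≈ -3 modulo p; the correction 12p turns -6p into +6p.
    F-third₂ : ∀ r t → r < n → suc (3 ℕ.* r) ≡ 2 ℕ.* n → + 3 * t ≈ - + 1 [ M ] →
      + 9 * F (+ r + P * t) n ≈ - (+ 2 * E - (+ 7 + + 6 * P)) [ M ]
    F-third₂ r t r<n e ht =
      alg P t E (+ r) (D n) (D r) (F (+ r + P * t) n) (inv (suc (2 ℕ.* r)))
        (F-value t r (ℕ.<⇒≤ r<n)) (P· D-third₂ r (ℕ.<⇒≤ r<n) e) (≡⇒≈ (P≡k+dr 2 3 r (cong suc e))) ht PD≈2E-4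
        (inverse-odd r r<n)
      where
      alg : ∀ P t E R D D′ F j → F ≈ - (+ 1 + + 2 * R) * (+ 1 + P * t * (D - + 2 * D′)) [ P * P ] →
        P * D′ ≈ P * (- + 2 * j) [ P * P ] → + 2 + + 3 * R ≈ P [ P * P ] → + 3 * t ≈ - + 1 [ P * P ] →
        P * D ≈ + 2 * E - + 4 [ P * P ] → j * (+ 1 + + 2 * R) ≈ + 1 [ P * P ] →
        + 9 * F ≈ - (+ 2 * E - (+ 7 + + 6 * P)) [ P * P ]
      alg P t E R D D′ F j hF hD hR ht hE hj =
        linear (+ 9 · hF ⊞ (- + 6 * (+ 1 + P * t * (D - + 2 * D′)) - + 8 * P * j) · hR
            ⊞ ((+ 1 - + 2 * P) * P * (D - + 2 * D′)) · ht
            ⊞ (- + 1) · hE ⊞ + 2 · hD ⊞ (+ 12 * P) · hj ⊞ (+ 2 * (D - + 2 * D′) - + 8 * j) · modulus (P * P))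
          (solve (P ∷ t ∷ E ∷ R ∷ D ∷ D′ ∷ F ∷ j ∷ []))

    -- From 3(2r+1) = p + 2 and D r ≈ D n one gets 9F ≈ -(p+2)(3 + p D n / 2) ≈ -(6 + 3p + p D n).
    F-sixth₁ : ∀ r t → 3 ℕ.* r ≡ n → + 6 * t ≈ - + 1 [ M ] →
      + 9 * F (+ r + P * t) n ≈ - (+ 2 * E + + 2 + + 3 * P) [ M ]
    F-sixth₁ r t e ht =
      alg P t E (+ r) (D n) (D r) (F (+ r + P * t) n)
        (F-value t r (ℕ.≤-trans (ℕ.m≤m+n r _) (ℕ.≤-reflexive e))) (P· D-sixth₁ r e)
        (≡⇒≈ (P≡1+dr 6 r (trans (ℕ.*-assoc 2 3 r) (cong (2 ℕ.*_) e)))) ht PD≈2E-4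
      where
      alg : ∀ P t E R D D′ F → F ≈ - (+ 1 + + 2 * R) * (+ 1 + P * t * (D - + 2 * D′)) [ P * P ] →
        P * D′ ≈ P * D [ P * P ] → + 1 + + 6 * R ≈ P [ P * P ] → + 6 * t ≈ - + 1 [ P * P ] →
        P * D ≈ + 2 * E - + 4 [ P * P ] → + 9 * F ≈ - (+ 2 * E + + 2 + + 3 * P) [ P * P ]
      alg P t E R D D′ F hF hD hR ht hE =
        linear (+ 9 · hF ⊞ (- + 3 * (+ 1 + P * t * (D - + 2 * D′))) · hR ⊞ (- (P * (D - + 2 * D′))) · ht
            ⊞ (- + 1) · hE ⊞ (- + 2) · hD ⊞ (- + 3 * t * (D - + 2 * D′)) · modulus (P * P))
          (solve (P ∷ t ∷ E ∷ R ∷ D ∷ D′ ∷ F ∷ []))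

    -- Here 3(2r+1) = p - 2, so 2/(2r+1) ≈ -3 modulo p; the correction 6p turns -3p into +3p.
    F-sixth₂ : ∀ r t → 2 ℕ.+ 3 ℕ.* r ≡ n → + 6 * t ≈ - + 1 [ M ] →
      + 9 * F (+ r + P * t) n ≈ + 2 * E + + 2 + + 3 * P [ M ]
    F-sixth₂ r t e ht =
      alg P t E (+ r) (D n) (D r) (F (+ r + P * t) n) (inv (suc (2 ℕ.* r)))
        (F-value t r (ℕ.<⇒≤ r<n)) (P· D-sixth₂ r e)
        (≡⇒≈ (P≡k+dr 5 6 r (trans (expand r) (cong (λ x → suc (2 ℕ.* x)) e)))) ht PD≈2E-4
        (inverse-odd r r<n)
      where
      r<n : r < n
      r<n = ℕ.≤-trans (s≤s (ℕ.≤-trans (ℕ.m≤m+n r _) (ℕ.n≤1+n (3 ℕ.* r)))) (ℕ.≤-reflexive e)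
      expand : ∀ r → 5 ℕ.+ 6 ℕ.* r ≡ suc (2 ℕ.* (2 ℕ.+ 3 ℕ.* r))
      expand = ℕ-Solver.solve-∀
      alg : ∀ P t E R D D′ F j → F ≈ - (+ 1 + + 2 * R) * (+ 1 + P * t * (D - + 2 * D′)) [ P * P ] →
        P * D′ ≈ P * (D - + 2 * j) [ P * P ] → + 5 + + 6 * R ≈ P [ P * P ] → + 6 * t ≈ - + 1 [ P * P ] →
        P * D ≈ + 2 * E - + 4 [ P * P ] → j * (+ 1 + + 2 * R) ≈ + 1 [ P * P ] →
        + 9 * F ≈ + 2 * E + + 2 + + 3 * P [ P * P ]
      alg P t E R D D′ F j hF hD hR ht hE hj =
        linear (+ 9 · hF ⊞ (- + 3 * (+ 1 + P * t * (D - + 2 * D′)) - + 2 * P * j) · hR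
            ⊞ (P * (D - + 2 * D′)) · ht ⊞ hE ⊞ + 2 · hD ⊞ (+ 6 * P) · hj
            ⊞ (- + 3 * t * (D - + 2 * D′) - + 2 * j) · modulus (P * P))
          (solve (P ∷ t ∷ E ∷ R ∷ D ∷ D′ ∷ F ∷ j ∷ []))

-- Factorial formulas and ratios of the coefficients.

choose-factorial : ∀ {n} a b → a ℕ.+ b ≡ n → (n C a) ℕ.* (a ! ℕ.* b !) ≡ n !
choose-factorial a b refl =
  subst (λ x → ((a ℕ.+ b) C a) ℕ.* (a ! ℕ.* x !) ≡ (a ℕ.+ b) !) (ℕ.m+n∸m≡n a b)
    (trans (cong (ℕ._* (a ! ℕ.* (a ℕ.+ b ℕ.∸ a) !)) (nCk≡n!/k![n-k]! (ℕ.m≤m+n a b)))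
           (ℕ.m/n*n≡m (k![n∸k]!∣n! (ℕ.m≤m+n a b))))
  where instance _ = ℕ._!*_!≢0 a (a ℕ.+ b ℕ.∸ a)

private
  k+k : ∀ k → k ℕ.+ k ≡ 2 ℕ.* k
  k+k = ℕ-Solver.solve-∀
  k+2k : ∀ k → k ℕ.+ 2 ℕ.* k ≡ 3 ℕ.* k
  k+2k = ℕ-Solver.solve-∀
  2k+2k : ∀ k → 2 ℕ.* k ℕ.+ 2 ℕ.* k ≡ 4 ℕ.* k
  2k+2k = ℕ-Solver.solve-∀
  3k+3k : ∀ k → 3 ℕ.* k ℕ.+ 3 ℕ.* k ≡ 6 ℕ.* k
  3k+3k = ℕ-Solver.solve-∀

-- The three coefficients are (4k)!/(k!² (2k)!), (3k)!/k!³ and (6k)!/(k! (2k)! (3k)!).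
β₁ β₂ β₃ : ℕ → ℕ
β₁ k = ((2 ℕ.* k) C k) ℕ.* ((4 ℕ.* k) C (2 ℕ.* k))
β₂ k = ((2 ℕ.* k) C k) ℕ.* ((3 ℕ.* k) C k)
β₃ k = ((3 ℕ.* k) C k) ℕ.* ((6 ℕ.* k) C (3 ℕ.* k))

β₁-factorial : ∀ k → β₁ k ℕ.* (k ! ℕ.* k ! ℕ.* (2 ℕ.* k) !) ≡ (4 ℕ.* k) !
β₁-factorial k =
  alg ((2 ℕ.* k) C k) ((4 ℕ.* k) C (2 ℕ.* k)) (k !) ((2 ℕ.* k) !)
    (choose-factorial k k (k+k k)) (choose-factorial (2 ℕ.* k) (2 ℕ.* k) (2k+2k k))
  where
  alg : ∀ {Z} A B x y → A ℕ.* (x ℕ.* x) ≡ y → B ℕ.* (y ℕ.* y) ≡ Z → A ℕ.* B ℕ.* (x ℕ.* x ℕ.* y) ≡ Z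
  alg A B x _ refl refl = arrange A B x
    where
    arrange : ∀ A B x → A ℕ.* B ℕ.* (x ℕ.* x ℕ.* (A ℕ.* (x ℕ.* x))) ≡ B ℕ.* (A ℕ.* (x ℕ.* x) ℕ.* (A ℕ.* (x ℕ.* x)))
    arrange = ℕ-Solver.solve-∀

β₂-factorial : ∀ k → β₂ k ℕ.* (k ! ℕ.* k ! ℕ.* k !) ≡ (3 ℕ.* k) !
β₂-factorial k =
  alg ((2 ℕ.* k) C k) ((3 ℕ.* k) C k) (k !) ((2 ℕ.* k) !)
    (choose-factorial k k (k+k k)) (choose-factorial k (2 ℕ.* k) (k+2k k))
  where
  alg : ∀ {Z} A B x y → A ℕ.* (x ℕ.* x) ≡ y → B ℕ.* (x ℕ.* y) ≡ Z → A ℕ.* B ℕ.* (x ℕ.* x ℕ.* x) ≡ Z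
  alg A B x _ refl refl = arrange A B x
    where
    arrange : ∀ A B x → A ℕ.* B ℕ.* (x ℕ.* x ℕ.* x) ≡ B ℕ.* (x ℕ.* (A ℕ.* (x ℕ.* x)))
    arrange = ℕ-Solver.solve-∀

β₃-factorial : ∀ k → β₃ k ℕ.* (k ! ℕ.* (2 ℕ.* k) ! ℕ.* (3 ℕ.* k) !) ≡ (6 ℕ.* k) !
β₃-factorial k =
  alg ((3 ℕ.* k) C k) ((6 ℕ.* k) C (3 ℕ.* k)) (k !) ((2 ℕ.* k) !) ((3 ℕ.* k) !)
    (choose-factorial k (2 ℕ.* k) (k+2k k)) (choose-factorial (3 ℕ.* k) (3 ℕ.* k) (3k+3k k))
  where
  alg : ∀ {Z} A B x y z → A ℕ.* (x ℕ.* y) ≡ z → B ℕ.* (z ℕ.* z) ≡ Z → A ℕ.* B ℕ.* (x ℕ.* y ℕ.* z) ≡ Z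
  alg A B x y _ refl refl = arrange A B x y
    where
    arrange : ∀ A B x y → A ℕ.* B ℕ.* (x ℕ.* y ℕ.* (A ℕ.* (x ℕ.* y))) ≡ B ℕ.* (A ℕ.* (x ℕ.* y) ℕ.* (A ℕ.* (x ℕ.* y)))
    arrange = ℕ-Solver.solve-∀

private
  double-factorial-suc : ∀ k → (2 ℕ.* suc k) ! ≡ (2 ℕ.+ 2 ℕ.* k) ℕ.* ((1 ℕ.+ 2 ℕ.* k) ℕ.* (2 ℕ.* k) !)
  double-factorial-suc k = cong _! (ℕ.*-suc 2 k)

  triple-factorial-suc : ∀ k → (3 ℕ.* suc k) ! ≡ (3 ℕ.+ 3 ℕ.* k) ℕ.* ((2 ℕ.+ 3 ℕ.* k) ℕ.* ((1 ℕ.+ 3 ℕ.* k) ℕ.* (3 ℕ.* k) !))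
  triple-factorial-suc k = cong _! (ℕ.*-suc 3 k)

-- Both sides are multiplied up to (4k+4)!. The ratio has the shape c (dk+1)(dk+e) of `u-scaled`
-- with c = d = 4, and c d² = 64 is the base of the denominator; for `β₂` it is 3 · 3² = 27.
β₁-suc : ∀ k → β₁ (suc k) ℕ.* (suc k ℕ.* suc k) ≡ 4 ℕ.* ((4 ℕ.* k ℕ.+ 1) ℕ.* (4 ℕ.* k ℕ.+ 3)) ℕ.* β₁ k
β₁-suc k = ℕ.*-cancelʳ-≡ _ _ (k ! ℕ.* k ! ℕ.* (2 ℕ.* k) ! ℕ.* ((2 ℕ.+ 2 ℕ.* k) ℕ.* (1 ℕ.+ 2 ℕ.* k))) (begin
  β₁ (suc k) ℕ.* (suc k ℕ.* suc k) ℕ.* (k ! ℕ.* k ! ℕ.* (2 ℕ.* k) ! ℕ.* ((2 ℕ.+ 2 ℕ.* k) ℕ.* (1 ℕ.+ 2 ℕ.* k)))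
    ≡⟨ collect (β₁ (suc k)) k (k !) ((2 ℕ.* k) !) ⟩
  β₁ (suc k) ℕ.* (suc k ! ℕ.* suc k ! ℕ.* ((2 ℕ.+ 2 ℕ.* k) ℕ.* ((1 ℕ.+ 2 ℕ.* k) ℕ.* (2 ℕ.* k) !)))
    ≡⟨ cong (λ x → β₁ (suc k) ℕ.* (suc k ! ℕ.* suc k ! ℕ.* x)) (sym (double-factorial-suc k)) ⟩
  β₁ (suc k) ℕ.* (suc k ! ℕ.* suc k ! ℕ.* (2 ℕ.* suc k) !)
    ≡⟨ β₁-factorial (suc k) ⟩
  (4 ℕ.* suc k) !
    ≡⟨ cong _! (ℕ.*-suc 4 k) ⟩
  (4 ℕ.+ 4 ℕ.* k) ℕ.* ((3 ℕ.+ 4 ℕ.* k) ℕ.* ((2 ℕ.+ 4 ℕ.* k) ℕ.* ((1 ℕ.+ 4 ℕ.* k) ℕ.* (4 ℕ.* k) !)))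
    ≡⟨ cong (λ x → (4 ℕ.+ 4 ℕ.* k) ℕ.* ((3 ℕ.+ 4 ℕ.* k) ℕ.* ((2 ℕ.+ 4 ℕ.* k) ℕ.* ((1 ℕ.+ 4 ℕ.* k) ℕ.* x)))) (sym (β₁-factorial k)) ⟩
  (4 ℕ.+ 4 ℕ.* k) ℕ.* ((3 ℕ.+ 4 ℕ.* k) ℕ.* ((2 ℕ.+ 4 ℕ.* k) ℕ.* ((1 ℕ.+ 4 ℕ.* k) ℕ.* (β₁ k ℕ.* (k ! ℕ.* k ! ℕ.* (2 ℕ.* k) !)))))
    ≡⟨ factor (β₁ k) k (k !) ((2 ℕ.* k) !) ⟩
  4 ℕ.* ((4 ℕ.* k ℕ.+ 1) ℕ.* (4 ℕ.* k ℕ.+ 3)) ℕ.* β₁ k ℕ.* (k ! ℕ.* k ! ℕ.* (2 ℕ.* k) ! ℕ.* ((2 ℕ.+ 2 ℕ.* k) ℕ.* (1 ℕ.+ 2 ℕ.* k))) ∎)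
  where
  open ≡-Reasoning
  instance
    _ = ℕ._!*_!≢0 k k
    _ = ℕ._!≢0 (2 ℕ.* k)
    _ = ℕ.m*n≢0 (k ! ℕ.* k !) ((2 ℕ.* k) !)
    _ = ℕ.m*n≢0 (k ! ℕ.* k ! ℕ.* (2 ℕ.* k) !) ((2 ℕ.+ 2 ℕ.* k) ℕ.* (1 ℕ.+ 2 ℕ.* k))
  collect : ∀ β k x y → β ℕ.* ((1 ℕ.+ k) ℕ.* (1 ℕ.+ k)) ℕ.* (x ℕ.* x ℕ.* y ℕ.* ((2 ℕ.+ 2 ℕ.* k) ℕ.* (1 ℕ.+ 2 ℕ.* k)))
    ≡ β ℕ.* ((1 ℕ.+ k) ℕ.* x ℕ.* ((1 ℕ.+ k) ℕ.* x) ℕ.* ((2 ℕ.+ 2 ℕ.* k) ℕ.* ((1 ℕ.+ 2 ℕ.* k) ℕ.* y)))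
  collect = ℕ-Solver.solve-∀
  factor : ∀ β k x y → (4 ℕ.+ 4 ℕ.* k) ℕ.* ((3 ℕ.+ 4 ℕ.* k) ℕ.* ((2 ℕ.+ 4 ℕ.* k) ℕ.* ((1 ℕ.+ 4 ℕ.* k) ℕ.* (β ℕ.* (x ℕ.* x ℕ.* y)))))
    ≡ 4 ℕ.* ((4 ℕ.* k ℕ.+ 1) ℕ.* (4 ℕ.* k ℕ.+ 3)) ℕ.* β ℕ.* (x ℕ.* x ℕ.* y ℕ.* ((2 ℕ.+ 2 ℕ.* k) ℕ.* (1 ℕ.+ 2 ℕ.* k)))
  factor = ℕ-Solver.solve-∀

β₂-suc : ∀ k → β₂ (suc k) ℕ.* (suc k ℕ.* suc k) ≡ 3 ℕ.* ((3 ℕ.* k ℕ.+ 1) ℕ.* (3 ℕ.* k ℕ.+ 2)) ℕ.* β₂ k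
β₂-suc k = ℕ.*-cancelʳ-≡ _ _ (k ! ℕ.* k ! ℕ.* k ! ℕ.* suc k) (begin
  β₂ (suc k) ℕ.* (suc k ℕ.* suc k) ℕ.* (k ! ℕ.* k ! ℕ.* k ! ℕ.* suc k)
    ≡⟨ collect (β₂ (suc k)) k (k !) ⟩
  β₂ (suc k) ℕ.* (suc k ! ℕ.* suc k ! ℕ.* suc k !)
    ≡⟨ β₂-factorial (suc k) ⟩
  (3 ℕ.* suc k) !
    ≡⟨ triple-factorial-suc k ⟩
  (3 ℕ.+ 3 ℕ.* k) ℕ.* ((2 ℕ.+ 3 ℕ.* k) ℕ.* ((1 ℕ.+ 3 ℕ.* k) ℕ.* (3 ℕ.* k) !))
    ≡⟨ cong (λ x → (3 ℕ.+ 3 ℕ.* k) ℕ.* ((2 ℕ.+ 3 ℕ.* k) ℕ.* ((1 ℕ.+ 3 ℕ.* k) ℕ.* x))) (sym (β₂-factorial k)) ⟩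
  (3 ℕ.+ 3 ℕ.* k) ℕ.* ((2 ℕ.+ 3 ℕ.* k) ℕ.* ((1 ℕ.+ 3 ℕ.* k) ℕ.* (β₂ k ℕ.* (k ! ℕ.* k ! ℕ.* k !))))
    ≡⟨ factor (β₂ k) k (k !) ⟩
  3 ℕ.* ((3 ℕ.* k ℕ.+ 1) ℕ.* (3 ℕ.* k ℕ.+ 2)) ℕ.* β₂ k ℕ.* (k ! ℕ.* k ! ℕ.* k ! ℕ.* suc k) ∎)
  where
  open ≡-Reasoning
  instance
    _ = ℕ._!*_!≢0 k k
    _ = ℕ._!≢0 k
    _ = ℕ.m*n≢0 (k ! ℕ.* k !) (k !)
    _ = ℕ.m*n≢0 (k ! ℕ.* k ! ℕ.* k !) (suc k)
  collect : ∀ β k x → β ℕ.* ((1 ℕ.+ k) ℕ.* (1 ℕ.+ k)) ℕ.* (x ℕ.* x ℕ.* x ℕ.* (1 ℕ.+ k))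
    ≡ β ℕ.* ((1 ℕ.+ k) ℕ.* x ℕ.* ((1 ℕ.+ k) ℕ.* x) ℕ.* ((1 ℕ.+ k) ℕ.* x))
  collect = ℕ-Solver.solve-∀
  factor : ∀ β k x → (3 ℕ.+ 3 ℕ.* k) ℕ.* ((2 ℕ.+ 3 ℕ.* k) ℕ.* ((1 ℕ.+ 3 ℕ.* k) ℕ.* (β ℕ.* (x ℕ.* x ℕ.* x))))
    ≡ 3 ℕ.* ((3 ℕ.* k ℕ.+ 1) ℕ.* (3 ℕ.* k ℕ.+ 2)) ℕ.* β ℕ.* (x ℕ.* x ℕ.* x ℕ.* (1 ℕ.+ k))
  factor = ℕ-Solver.solve-∀

-- The same argument with (6k+6)!; the factor 12 is what makes c d² = 12 · 6² = 432.
β₃-suc : ∀ k → β₃ (suc k) ℕ.* (suc k ℕ.* suc k) ≡ 12 ℕ.* ((6 ℕ.* k ℕ.+ 1) ℕ.* (6 ℕ.* k ℕ.+ 5)) ℕ.* β₃ k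
β₃-suc k = ℕ.*-cancelʳ-≡ _ _ (k ! ℕ.* (2 ℕ.* k) ! ℕ.* (3 ℕ.* k) ! ℕ.* c k) (begin
  β₃ (suc k) ℕ.* (suc k ℕ.* suc k) ℕ.* (k ! ℕ.* (2 ℕ.* k) ! ℕ.* (3 ℕ.* k) ! ℕ.* c k)
    ≡⟨ collect (β₃ (suc k)) k (k !) ((2 ℕ.* k) !) ((3 ℕ.* k) !) ⟩
  β₃ (suc k) ℕ.* (suc k ! ℕ.* ((2 ℕ.+ 2 ℕ.* k) ℕ.* ((1 ℕ.+ 2 ℕ.* k) ℕ.* (2 ℕ.* k) !))
      ℕ.* ((3 ℕ.+ 3 ℕ.* k) ℕ.* ((2 ℕ.+ 3 ℕ.* k) ℕ.* ((1 ℕ.+ 3 ℕ.* k) ℕ.* (3 ℕ.* k) !))))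
    ≡⟨ cong₂ (λ x y → β₃ (suc k) ℕ.* (suc k ! ℕ.* x ℕ.* y)) (sym (double-factorial-suc k)) (sym (triple-factorial-suc k)) ⟩
  β₃ (suc k) ℕ.* (suc k ! ℕ.* (2 ℕ.* suc k) ! ℕ.* (3 ℕ.* suc k) !)
    ≡⟨ β₃-factorial (suc k) ⟩
  (6 ℕ.* suc k) !
    ≡⟨ cong _! (ℕ.*-suc 6 k) ⟩
  descend k ((6 ℕ.* k) !)
    ≡⟨ cong (descend k) (sym (β₃-factorial k)) ⟩
  descend k (β₃ k ℕ.* (k ! ℕ.* (2 ℕ.* k) ! ℕ.* (3 ℕ.* k) !))
    ≡⟨ factor (β₃ k) k (k !) ((2 ℕ.* k) !) ((3 ℕ.* k) !) ⟩
  12 ℕ.* ((6 ℕ.* k ℕ.+ 1) ℕ.* (6 ℕ.* k ℕ.+ 5)) ℕ.* β₃ k ℕ.* (k ! ℕ.* (2 ℕ.* k) ! ℕ.* (3 ℕ.* k) ! ℕ.* c k) ∎)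
  where
  open ≡-Reasoning
  c : ℕ → ℕ
  c k = 2 ℕ.* (1 ℕ.+ 2 ℕ.* k) ℕ.* ((3 ℕ.+ 3 ℕ.* k) ℕ.* (2 ℕ.+ 3 ℕ.* k) ℕ.* (1 ℕ.+ 3 ℕ.* k))
  descend : ℕ → ℕ → ℕ
  descend k x = (6 ℕ.+ 6 ℕ.* k) ℕ.* ((5 ℕ.+ 6 ℕ.* k) ℕ.* ((4 ℕ.+ 6 ℕ.* k) ℕ.*
    ((3 ℕ.+ 6 ℕ.* k) ℕ.* ((2 ℕ.+ 6 ℕ.* k) ℕ.* ((1 ℕ.+ 6 ℕ.* k) ℕ.* x)))))
  instance
    _ = ℕ._!*_!≢0 k (2 ℕ.* k)
    _ = ℕ._!≢0 (3 ℕ.* k)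
    _ = ℕ.m*n≢0 (k ! ℕ.* (2 ℕ.* k) !) ((3 ℕ.* k) !)
    _ = ℕ.m*n≢0 (k ! ℕ.* (2 ℕ.* k) ! ℕ.* (3 ℕ.* k) !) (c k)
  collect : ∀ β k x y z → β ℕ.* ((1 ℕ.+ k) ℕ.* (1 ℕ.+ k)) ℕ.* (x ℕ.* y ℕ.* z ℕ.*
      (2 ℕ.* (1 ℕ.+ 2 ℕ.* k) ℕ.* ((3 ℕ.+ 3 ℕ.* k) ℕ.* (2 ℕ.+ 3 ℕ.* k) ℕ.* (1 ℕ.+ 3 ℕ.* k))))
    ≡ β ℕ.* ((1 ℕ.+ k) ℕ.* x ℕ.* ((2 ℕ.+ 2 ℕ.* k) ℕ.* ((1 ℕ.+ 2 ℕ.* k) ℕ.* y))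
      ℕ.* ((3 ℕ.+ 3 ℕ.* k) ℕ.* ((2 ℕ.+ 3 ℕ.* k) ℕ.* ((1 ℕ.+ 3 ℕ.* k) ℕ.* z))))
  collect = ℕ-Solver.solve-∀
  factor : ∀ β k x y z → (6 ℕ.+ 6 ℕ.* k) ℕ.* ((5 ℕ.+ 6 ℕ.* k) ℕ.* ((4 ℕ.+ 6 ℕ.* k) ℕ.*
      ((3 ℕ.+ 6 ℕ.* k) ℕ.* ((2 ℕ.+ 6 ℕ.* k) ℕ.* ((1 ℕ.+ 6 ℕ.* k) ℕ.* (β ℕ.* (x ℕ.* y ℕ.* z)))))))
    ≡ 12 ℕ.* ((6 ℕ.* k ℕ.+ 1) ℕ.* (6 ℕ.* k ℕ.+ 5)) ℕ.* β ℕ.* (x ℕ.* y ℕ.* z ℕ.*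
      (2 ℕ.* (1 ℕ.+ 2 ℕ.* k) ℕ.* ((3 ℕ.+ 3 ℕ.* k) ℕ.* (2 ℕ.+ 3 ℕ.* k) ℕ.* (1 ℕ.+ 3 ℕ.* k))))
  factor = ℕ-Solver.solve-∀

-- Ratios and row sums of binomial coefficients.

binomial-ratio : ∀ {m} N k → (+ 1 + + k) * + (N C suc k) ≈ (+ N - + k) * + (N C k) [ m ]
binomial-ratio zero    zero    = ≡⇒≈ refl
binomial-ratio zero    (suc k) = ≡⇒≈ (vanish (+ k))
  where
  vanish : ∀ x → (+ 1 + (+ 1 + x)) * + 0 ≡ (+ 0 - (+ 1 + x)) * + 0
  vanish x = solve (x ∷ [])
binomial-ratio (suc N) zero    =
  alg (+ (N C 1)) (+ (suc N C 1)) (+ N) (≡⇒≈ (cong +_ (sym (nCk+nC[k+1]≡[n+1]C[k+1] N 0)))) (binomial-ratio N 0)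
  where
  alg : ∀ {m} x y N → y ≈ + 1 + x [ m ] → (+ 1 + + 0) * x ≈ (N - + 0) * + 1 [ m ] → (+ 1 + + 0) * y ≈ (+ 1 + N - + 0) * + 1 [ m ]
  alg x y N h h₀ = linear (h ⊞ h₀) (solve (x ∷ y ∷ N ∷ []))
binomial-ratio (suc N) (suc k) =
  alg (+ (N C k)) (+ (N C suc k)) (+ (N C suc (suc k))) (+ (suc N C suc k)) (+ (suc N C suc (suc k))) (+ N) (+ k)
    (≡⇒≈ (cong +_ (sym (nCk+nC[k+1]≡[n+1]C[k+1] N k)))) (≡⇒≈ (cong +_ (sym (nCk+nC[k+1]≡[n+1]C[k+1] N (suc k)))))
    (binomial-ratio N k) (binomial-ratio N (suc k))
  where
  alg : ∀ {m} a b c x y N K → x ≈ a + b [ m ] → y ≈ b + c [ m ] → (+ 1 + K) * b ≈ (N - K) * a [ m ] →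
    (+ 1 + (+ 1 + K)) * c ≈ (N - (+ 1 + K)) * b [ m ] → (+ 1 + (+ 1 + K)) * y ≈ (+ 1 + N - (+ 1 + K)) * x [ m ]
  alg a b c x y N K hx hy h h′ =
    -- By Pascal's rule both sides reduce to (N + 1) b, with b the entry of row N shared by x and y.
    linear ((- (N - K)) · hx ⊞ (+ 2 + K) · hy ⊞ h ⊞ h′) (solve (a ∷ b ∷ c ∷ x ∷ y ∷ N ∷ K ∷ []))

binomial-sum : ∀ N → partial-sum (λ k → + (N C k)) N ≡ + (2 ℕ.^ N)
binomial-sum zero    = refl
binomial-sum (suc N) = begin
  row (suc N) (suc N)                ≡⟨ row-suc N ⟩
  row N N + + (N C suc N) + row N N  ≡⟨ cong (λ x → row N N + + x + row N N) (k>n⇒nCk≡0 (ℕ.n<1+n N)) ⟩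
  row N N + + 0 + row N N            ≡⟨ cong (λ x → x + + 0 + x) (binomial-sum N) ⟩
  + (2 ℕ.^ N ℕ.+ 0 ℕ.+ 2 ℕ.^ N)      ≡⟨ cong +_ (rearrange (2 ℕ.^ N)) ⟩
  + (2 ℕ.^ suc N)                    ∎
  where
  open ≡-Reasoning
  row : ℕ → ℕ → ℤ
  row N = partial-sum (λ k → + (N C k))
  rearrange : ∀ x → x ℕ.+ 0 ℕ.+ x ≡ 2 ℕ.* x
  rearrange = ℕ-Solver.solve-∀
  swap : ∀ a b → a + (a + b) ≡ a + b + a
  swap a b = solve (a ∷ b ∷ [])
  -- Pascal's rule summed over a partial row: the entries of row N up to m occur twice, the entry m
  -- + 1 once.
  row-suc : ∀ m → row (suc N) (suc m) ≡ row N m + + (N C suc m) + row N m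
  row-suc zero    = trans (cong (λ x → + 1 + + x) (sym (nCk+nC[k+1]≡[n+1]C[k+1] N 0))) (swap (+ 1) (+ (N C 1)))
  row-suc (suc m) = trans
    (cong₂ _+_ (row-suc m) (cong +_ (sym (nCk+nC[k+1]≡[n+1]C[k+1] N (suc m)))))
    (exchange (row N m) (+ (N C suc m)) (+ (N C suc (suc m))))
    where
    exchange : ∀ r a b → r + a + r + (a + b) ≡ r + a + b + (r + a)
    exchange r a b = solve (r ∷ a ∷ b ∷ [])

-- Images modulo p² of rationals with denominator prime to p.

module Localization (p : ℕ) (prime-p : Prime p) where

  M : ℤ
  M = + p * + p

  ∤-* : ∀ {a b} → ¬ p ∣ a → ¬ p ∣ b → ¬ p ∣ a ℕ.* b
  ∤-* {a} {b} p∤a p∤b p∣ab = [ p∤a , p∤b ]′ (euclidsLemma a b prime-p p∣ab)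

  ∤1 : ¬ p ∣ 1
  ∤1 p∣1 = ¬prime[1] (subst Prime (∣1⇒≡1 p∣1) prime-p)

  ∤-^ : ∀ {a} → ¬ p ∣ a → ∀ k → ¬ p ∣ a ℕ.^ k
  ∤-^ p∤a zero    = ∤1
  ∤-^ p∤a (suc k) = ∤-* p∤a (∤-^ p∤a k)

  private
    -- One Newton step lifts an inverse modulo p to an inverse modulo p².
    lift-inverse : ∀ P i k → i * k ≈ + 1 [ P ] → (+ 2 * i - i * i * k) * k ≈ + 1 [ P * P ]
    lift-inverse P i k (mod q e) = mod (- (q * q)) (trans (square i k) (trans (cong (λ x → - (x * x)) e) (regroup q P)))
      where
      square : ∀ i k → (+ 2 * i - i * i * k) * k - + 1 ≡ - ((i * k - + 1) * (i * k - + 1))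
      square i k = solve (i ∷ k ∷ [])
      regroup : ∀ q P → - (q * P * (q * P)) ≡ - (q * q) * (P * P)
      regroup q P = solve (q ∷ P ∷ [])

    pos-+* : ∀ a b c → + (a ℕ.+ b ℕ.* c) ≡ + a + + b * + c
    pos-+* a b c = cong (λ x → + a + x) (ℤ.pos-* b c)

    inverse-mod-p : ∀ k → ¬ p ∣ k → ∃ λ i → i * + k ≈ + 1 [ + p ]
    inverse-mod-p k p∤k with coprime-Bézout coprime
      where
      coprime : Coprime k p
      coprime (d∣k , d∣p) with prime⇒irreducible prime-p d∣p
      ... | inj₁ d≡1  = d≡1
      ... | inj₂ refl = contradiction d∣k p∤k
    ... | Bézout.+- x y eq = + x , alg (+ p) (+ k) (+ x) (+ y) (≡⇒≈ (trans (sym (pos-+* 1 y p)) (trans (cong +_ eq) (ℤ.pos-* x k))))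
      where
      alg : ∀ P k x y → + 1 + y * P ≈ x * k [ P ] → x * k ≈ + 1 [ P ]
      alg P k x y h = linear ((- + 1) · h ⊞ y · modulus P) (solve (P ∷ k ∷ x ∷ y ∷ []))
    ... | Bézout.-+ x y eq = - + x , alg (+ p) (+ k) (+ x) (+ y) (≡⇒≈ (trans (sym (pos-+* 1 x k)) (trans (cong +_ eq) (ℤ.pos-* y p))))
      where
      alg : ∀ P k x y → + 1 + x * k ≈ y * P [ P ] → - x * k ≈ + 1 [ P ]
      alg P k x y h = linear ((- + 1) · h ⊞ (- y) · modulus P) (solve (P ∷ k ∷ x ∷ y ∷ []))

    -- The value 0 is a placeholder at multiples of p. Elsewhere the Bézout inverse is lifted by the
    -- Newton step.
    inverse-of : ∀ k → Dec (p ∣ k) → ℤ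
    inverse-of k (yes _)   = + 0
    inverse-of k (no p∤k) = let i = proj₁ (inverse-mod-p k p∤k) in + 2 * i - i * i * + k

  inv : ℕ → ℤ
  inv k = inverse-of k (p ∣? k)

  inverse : ∀ k → ¬ p ∣ k → inv k * + k ≈ + 1 [ M ]
  inverse k p∤k with p ∣? k
  ... | yes p∣k  = contradiction p∣k p∤k
  ... | no  p∤k′ = lift-inverse (+ p) (proj₁ (inverse-mod-p k p∤k′)) (+ k) (proj₂ (inverse-mod-p k p∤k′))

  -- u is the image of the p-integral rational x in ℤ/p².
  record Represents (x : ℚ) (u : ℤ) : Set where
    constructor represents
    field
      fraction : ℚᵘ
      equal    : toℚᵘ x ≃ fraction
      integral : ¬ p ∣ ℚᵘ.↧ₙ fraction
      residue  : ℚᵘ.↥ fraction ≈ u * ℚᵘ.↧ fraction [ M ]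

  adjust : ∀ {x u v} → u ≈ v [ M ] → Represents x u → Represents x v
  adjust {u = u} {v} h (represents q@(mkℚᵘ a b) e p∤b r) = represents q e p∤b (alg a (+ suc b) u v r h)
    where
    alg : ∀ {m} a b u v → a ≈ u * b [ m ] → u ≈ v [ m ] → a ≈ v * b [ m ]
    alg a b u v h h′ = linear (h ⊞ b · h′) (solve (a ∷ b ∷ u ∷ v ∷ []))

  represents-+ : ∀ {x y u v} → Represents x u → Represents y v → Represents (x ℚ.+ y) (u + v)
  represents-+ {x} {y} {u} {v} (represents q@(mkℚᵘ a b) e p∤b h) (represents r@(mkℚᵘ c d) f p∤d h′) =
    represents (q ℚᵘ.+ r) (ℚᵘ.≃-trans (ℚ.toℚᵘ-homo-+ x y) (ℚᵘ.+-cong e f)) (∤-* p∤b p∤d)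
      (alg a (+ suc b) c (+ suc d) u v h h′)
    where
    alg : ∀ {m} a b c d u v → a ≈ u * b [ m ] → c ≈ v * d [ m ] → a * d + c * b ≈ (u + v) * (b * d) [ m ]
    alg a b c d u v h h′ = linear (d · h ⊞ b · h′) (solve (a ∷ b ∷ c ∷ d ∷ u ∷ v ∷ []))

  represents-* : ∀ {x y u v} → Represents x u → Represents y v → Represents (x ℚ.* y) (u * v)
  represents-* {x} {y} {u} {v} (represents q@(mkℚᵘ a b) e p∤b h) (represents r@(mkℚᵘ c d) f p∤d h′) =
    represents (q ℚᵘ.* r) (ℚᵘ.≃-trans (ℚ.toℚᵘ-homo-* x y) (ℚᵘ.*-cong e f)) (∤-* p∤b p∤d)
      (alg a (+ suc b) c (+ suc d) u v h h′)
    where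
    alg : ∀ {m} a b c d u v → a ≈ u * b [ m ] → c ≈ v * d [ m ] → a * c ≈ u * v * (b * d) [ m ]
    alg a b c d u v h h′ = linear (c · h ⊞ (u * b) · h′) (solve (a ∷ b ∷ c ∷ d ∷ u ∷ v ∷ []))

  represents-neg : ∀ {x u} → Represents x u → Represents (ℚ.- x) (- u)
  represents-neg {x} {u} (represents q@(mkℚᵘ a b) e p∤b h) =
    represents (ℚᵘ.- q) (ℚᵘ.≃-trans (ℚ.toℚᵘ-homo‿- x) (ℚᵘ.-‿cong e)) p∤b (alg a (+ suc b) u h)
    where
    alg : ∀ {m} a b u → a ≈ u * b [ m ] → - a ≈ - u * b [ m ]
    alg a b u h = linear ((- + 1) · h) (solve (a ∷ b ∷ u ∷ []))

  represents-/ : ∀ a b u → ¬ p ∣ b → + a ≈ u * + b [ M ] → Represents (a /ℕ b) u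
  represents-/ a zero    u p∤0 _ = contradiction (p ∣0) p∤0
  represents-/ a (suc b) u p∤b h = represents (mkℚᵘ (+ a) b) (ℚ.toℚᵘ-fromℚᵘ (mkℚᵘ (+ a) b)) p∤b h

  represents-ℕ : ∀ a → Represents (a /ℕ 1) (+ a)
  represents-ℕ a = represents-/ a 1 (+ a) ∤1 (≡⇒≈ (sym (ℤ.*-identityʳ (+ a))))

  represents-1/ : ∀ b → ¬ p ∣ b → Represents (1 /ℕ b) (inv b)
  represents-1/ b p∤b = represents-/ 1 b (inv b) p∤b (≈-sym (inverse b p∤b))

  represents-1 : Represents ℚ.1ℚ (+ 1)
  represents-1 = represents-ℕ 1

  private
    p²∣ : ∀ {i} → i ≈ + 0 [ M ] → p ℕ.^ 2 ∣ ℤ.∣ i ∣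
    p²∣ {i} (mod q e) = divides ℤ.∣ q ∣ (trans (cong ℤ.∣_∣ (trans (sym (ℤ.+-identityʳ i)) e))
      (trans (ℤ.abs-* q M) (cong (ℤ.∣ q ∣ ℕ.*_) (trans (ℤ.abs-* (+ p) (+ p)) (cong (p ℕ.*_) (sym (ℕ.*-identityʳ p)))))))

  -- The reduced denominator divides that of any fraction equal to x, so p cannot divide it.
  -- Cross-multiplying and inverting the denominator prime to p carries divisibility by p² over to
  -- the reduced numerator.
  represents-0 : ∀ {x} → Represents x (+ 0) → (¬ p ∣ ℚ.↧ₙ x) × (p ℕ.^ 2 ∣ ℤ.∣ ℚ.↥ x ∣)
  represents-0 {x@(mkℚ n d-1 c)} (represents (mkℚᵘ a b) (*≡* e) p∤b h) =
    (λ p∣d → p∤b (∣-trans p∣d d∣b)) , p²∣ (alg n (+ suc d-1) a (+ suc b) (inv (suc b)) (≡⇒≈ e) h (inverse (suc b) p∤b))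
    where
    d∣b : suc d-1 ∣ suc b
    d∣b = coprime-divisor (Coprimality.sym (Coprimality.recompute c))
      (divides ℤ.∣ a ∣ (trans (sym (ℤ.abs-* n (+ suc b))) (trans (cong ℤ.∣_∣ e) (ℤ.abs-* a (+ suc d-1)))))
    alg : ∀ {m} n d a b i → n * b ≈ a * d [ m ] → a ≈ + 0 * b [ m ] → i * b ≈ + 1 [ m ] → n ≈ + 0 [ m ]
    alg n d a b i h ha hi = linear ((- n) · hi ⊞ i · h ⊞ (i * d) · ha) (solve (n ∷ d ∷ a ∷ b ∷ i ∷ []))

  represents⇒≡ : ∀ {x y u v} → Represents x u → Represents y v → u ≈ v [ M ] → x ≡ y [mod p ℕ.^ 2 ∣ p ]
  represents⇒≡ {u = u} {v} hx hy h = represents-0 (adjust (alg u v h) (represents-+ hx (represents-neg hy)))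
    where
    alg : ∀ {m} u v → u ≈ v [ m ] → u + - v ≈ + 0 [ m ]
    alg u v h = linear h (solve (u ∷ v ∷ []))

-- Signs, and assembly of the three congruences.

leg3-1 : ∀ p → p % 3 ≡ 1 → leg3 p ≡ ℚ.1ℚ
leg3-1 p e with p % 3
leg3-1 p refl | .1 = refl

leg3-2 : ∀ p → p % 3 ≡ 2 → leg3 p ≡ ℚ.- ℚ.1ℚ
leg3-2 p e with p % 3
leg3-2 p refl | .2 = refl

ℚpow-even : ∀ r → ℚpow (ℚ.- ℚ.1ℚ) (2 ℕ.* r) ≡ ℚ.1ℚ
ℚpow-even zero    = refl
ℚpow-even (suc r) = trans (cong (ℚpow (ℚ.- ℚ.1ℚ)) (ℕ.*-suc 2 r)) (cong (λ x → ℚ.- ℚ.1ℚ ℚ.* (ℚ.- ℚ.1ℚ ℚ.* x)) (ℚpow-even r))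

module Sums (n : ℕ) (prime-p : Prime (suc (2 ℕ.* n))) (p>3 : suc (2 ℕ.* n) > 3) where

  p : ℕ
  p = suc (2 ℕ.* n)

  open Localization p prime-p hiding (M)

  ∤-suc : ∀ k → k < 2 ℕ.* n → ¬ p ∣ suc k
  ∤-suc k k<2n = >⇒∤ (s≤s k<2n)

  open Truncated n inv (λ k k<2n → inverse (suc k) (∤-suc k k<2n))

  ∤2 : ¬ p ∣ 2
  ∤2 = >⇒∤ (ℕ.<-trans ℕ.≤-refl p>3)

  ∤3 : ¬ p ∣ 3
  ∤3 = >⇒∤ p>3

  E : ℤ
  E = + (2 ℕ.^ p)

  PD≈2E-4 : P * D n ≈ + 2 * E - + 4 [ M ]
  PD≈2E-4 = ≈-trans
    (PD≈2T-4 (λ k → + (p C k)) refl (binomial-ratio p) (cong +_ (nCn≡1 p)))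
    (≡⇒≈ (cong (λ x → + 2 * x - + 4) (binomial-sum p)))

  represents-sum : ∀ (x : ℕ → ℚ) (w : ℕ → ℤ) → (∀ k → k ≤ n → Represents (x k) (w k)) →
    ∀ m → m ≤ n → Represents (Σ≤ m (λ k → x k ℚ.* inv2k-1 k)) (weighted-sum w m)
  represents-sum x w h zero    _   = adjust (≡⇒≈ (alg (w 0))) (represents-* (h 0 z≤n) (represents-neg represents-1))
    where
    alg : ∀ y → y * - + 1 ≡ - y
    alg y = solve (y ∷ [])
  represents-sum x w h (suc m) m<n =
    represents-+ (represents-sum x w h m (ℕ.<⇒≤ m<n))
      (represents-* (h (suc m) m<n) (represents-1/ (suc (2 ℕ.* m)) (∤-suc (2 ℕ.* m) (ℕ.*-monoʳ-< 2 m<n))))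

  represents-F : ∀ a c e → + suc e * + suc e * (a * (a + + 1)) ≈ - + e [ M ] → ¬ p ∣ c ℕ.* (suc e ℕ.* suc e) →
    (β : ℕ → ℕ) → β 0 ≡ 1 →
    (∀ k → β (suc k) ℕ.* (suc k ℕ.* suc k) ≡ c ℕ.* ((suc e ℕ.* k ℕ.+ 1) ℕ.* (suc e ℕ.* k ℕ.+ e)) ℕ.* β k) →
    Represents (Σ≤ n (λ k → (β k /ℕ ((c ℕ.* (suc e ℕ.* suc e)) ℕ.^ k)) ℚ.* inv2k-1 k)) (F a n)
  represents-F a c e ha p∤B β β-zero β-suc =
    represents-sum _ (u a)
      (λ k k≤n → represents-/ (β k) _ (u a k) (∤-^ p∤B k) (u-scaled a c e ha β β-zero β-suc k k≤n))
      n ℕ.≤-refl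

  minus-inverse : ∀ d → ¬ p ∣ d → + d * - inv d ≈ - + 1 [ M ]
  minus-inverse d p∤d = alg (+ d) (inv d) (inverse d p∤d)
    where
    alg : ∀ {m} d i → i * d ≈ + 1 [ m ] → d * - i ≈ - + 1 [ m ]
    alg d i h = linear ((- + 1) · h) (solve (d ∷ i ∷ []))

  t₃ t₄ t₆ : ℤ
  t₃ = - inv 3
  t₄ = - inv 4
  t₆ = - inv 6

  ∤4 : ¬ p ∣ 4
  ∤4 = ∤-* ∤2 ∤2

  ∤6 : ¬ p ∣ 6
  ∤6 = ∤-* ∤2 ∤3

  ∤9 : ¬ p ∣ 9
  ∤9 = ∤-* ∤3 ∤3

  -- The number e is p modulo 4: the argument stands for -1/4 when e = 1 and for -3/4 when e = 3,
  -- two points where F agrees.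
  represents-t1 : ∀ e r → + e * (+ 4 - + e) ≡ + 3 → e ℕ.+ 4 ℕ.* r ≡ p → Represents (Σ≤ n t1) (F (+ r + P * t₄) n)
  represents-t1 e r he hr =
    represents-F (+ r + P * t₄) 4 3 (shifted-argument (+ 4) (+ e) (+ 3) (+ r) t₄ (minus-inverse 4 ∤4) (P≡k+dr e 4 r hr) he)
      (∤-* ∤4 (∤-* ∤4 ∤4)) β₁ refl β₁-suc

  represents-t2 : ∀ e r → + e * (+ 3 - + e) ≡ + 2 → e ℕ.+ 3 ℕ.* r ≡ p → Represents (Σ≤ n t2) (F (+ r + P * t₃) n)
  represents-t2 e r he hr =
    represents-F (+ r + P * t₃) 3 2 (shifted-argument (+ 3) (+ e) (+ 2) (+ r) t₃ (minus-inverse 3 ∤3) (P≡k+dr e 3 r hr) he)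
      (∤-* ∤3 (∤-* ∤3 ∤3)) β₂ refl β₂-suc

  represents-t3 : ∀ e r → + e * (+ 6 - + e) ≡ + 5 → e ℕ.+ 6 ℕ.* r ≡ p → Represents (Σ≤ n t3) (F (+ r + P * t₆) n)
  represents-t3 e r he hr =
    represents-F (+ r + P * t₆) 12 5 (shifted-argument (+ 6) (+ e) (+ 5) (+ r) t₆ (minus-inverse 6 ∤6) (P≡k+dr e 6 r hr) he)
      (∤-* (∤-* ∤2 ∤6) (∤-* ∤6 ∤6)) β₃ refl β₃-suc

  -- The parity of n decides p modulo 4. The exponent is n + 1, so even n gives the sign -1. The
  -- variables m and m′ stand for the halves (p-1)/2 and (p+1)/2.
  sum-t1 : ∀ {m m′} → m ≡ n → m′ ≡ suc n → Σ≤ m t1 ≡ ℚpow (ℚ.- ℚ.1ℚ) m′ ℚ.* (m′ /ℕ 1) [mod p ℕ.^ 2 ∣ p ]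
  sum-t1 refl refl with n divMod 2
  ... | result r zero e =
    represents⇒≡ (represents-t1 1 r refl (trans (expand r) (cong (λ x → suc (2 ℕ.* x)) 2r≡n)))
      (represents-* (subst (λ x → Represents x (- + 1)) (sym sign) (represents-neg represents-1)) (represents-ℕ (suc n)))
      (≈-trans (F-quarter₁ r t₄ 2r≡n (minus-inverse 4 ∤4)) (≡⇒≈ (negate (+ suc n))))
    where
    2r≡n : 2 ℕ.* r ≡ n
    2r≡n = trans (ℕ.*-comm 2 r) (sym e)
    expand : ∀ r → 1 ℕ.+ 4 ℕ.* r ≡ suc (2 ℕ.* (2 ℕ.* r))
    expand = ℕ-Solver.solve-∀
    sign : ℚpow (ℚ.- ℚ.1ℚ) (suc n) ≡ ℚ.- ℚ.1ℚ
    sign = trans (cong (λ x → ℚpow (ℚ.- ℚ.1ℚ) (suc x)) (sym 2r≡n)) (cong (ℚ.- ℚ.1ℚ ℚ.*_) (ℚpow-even r))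
    negate : ∀ x → - x ≡ - + 1 * x
    negate x = solve (x ∷ [])
  ... | result r (suc zero) e =
    represents⇒≡ (represents-t1 3 r refl (trans (expand r) (cong (λ x → suc (2 ℕ.* x)) 1+2r≡n)))
      (represents-* (subst (λ x → Represents x (+ 1)) (sym sign) represents-1) (represents-ℕ (suc n)))
      (≈-trans (F-quarter₂ r t₄ 1+2r≡n (minus-inverse 4 ∤4)) (≡⇒≈ (sym (ℤ.*-identityˡ (+ suc n)))))
    where
    1+2r≡n : suc (2 ℕ.* r) ≡ n
    1+2r≡n = trans (cong suc (ℕ.*-comm 2 r)) (sym e)
    expand : ∀ r → 3 ℕ.+ 4 ℕ.* r ≡ suc (2 ℕ.* suc (2 ℕ.* r))
    expand = ℕ-Solver.solve-∀
    sign : ℚpow (ℚ.- ℚ.1ℚ) (suc n) ≡ ℚ.1ℚ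
    sign = trans (cong (ℚpow (ℚ.- ℚ.1ℚ)) (trans (cong suc (sym 1+2r≡n)) (sym (ℕ.*-suc 2 r)))) (ℚpow-even (suc r))

  2^[p+1]≡2E : + (2 ℕ.^ (p ℕ.+ 1)) ≡ + 2 * E
  2^[p+1]≡2E = trans (cong (λ x → + (2 ℕ.^ x)) (ℕ.+-comm p 1)) (ℤ.pos-* 2 (2 ℕ.^ p))

  sum-t2-from : ∀ l {a} → Represents (leg3 p) l → Represents (Σ≤ n t2) (F a n) →
    + 9 * F a n ≈ l * (+ 2 * E - (+ 7 + + 6 * P)) [ M ] →
    Σ≤ n t2 ≡ (1 /ℕ 9) ℚ.* leg3 p ℚ.* ((2 ℕ.^ (p ℕ.+ 1)) /ℕ 1 ℚ.- (7 ℕ.+ 6 ℕ.* p) /ℕ 1) [mod p ℕ.^ 2 ∣ p ]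
  sum-t2-from l {a} hl hF h =
    represents⇒≡ hF
      (represents-* (represents-* (represents-1/ 9 ∤9) hl)
        (represents-+ (represents-ℕ (2 ℕ.^ (p ℕ.+ 1))) (represents-neg (represents-ℕ (7 ℕ.+ 6 ℕ.* p)))))
      (alg (F a n) l (inv 9) (+ (2 ℕ.^ (p ℕ.+ 1))) (+ (7 ℕ.+ 6 ℕ.* p)) E P h (inverse 9 ∤9)
        (≡⇒≈ 2^[p+1]≡2E) (≡⇒≈ (cong (λ x → + 7 + x) (ℤ.pos-* 6 p))))
    where
    alg : ∀ {m} F l i A B E P → + 9 * F ≈ l * (+ 2 * E - (+ 7 + + 6 * P)) [ m ] → i * + 9 ≈ + 1 [ m ] →
      A ≈ + 2 * E [ m ] → B ≈ + 7 + + 6 * P [ m ] → F ≈ i * l * (A + - B) [ m ]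
    alg F l i A B E P h hi hA hB =
      linear (i · h ⊞ (- F) · hi ⊞ (- (i * l)) · hA ⊞ (i * l) · hB) (solve (F ∷ l ∷ i ∷ A ∷ B ∷ E ∷ P ∷ []))

  sum-t3-from : ∀ l {a} → Represents (leg3 p) l → Represents (Σ≤ n t3) (F a n) →
    + 9 * F a n ≈ - (l * (+ 2 * E + + 2 + + 3 * P)) [ M ] →
    Σ≤ n t3 ≡ ℚ.- ((1 /ℕ 9) ℚ.* leg3 p ℚ.* ((2 ℕ.^ (p ℕ.+ 1) ℕ.+ 2 ℕ.+ 3 ℕ.* p) /ℕ 1)) [mod p ℕ.^ 2 ∣ p ]
  sum-t3-from l {a} hl hF h =
    represents⇒≡ hF
      (represents-neg (represents-* (represents-* (represents-1/ 9 ∤9) hl)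
        (represents-ℕ (2 ℕ.^ (p ℕ.+ 1) ℕ.+ 2 ℕ.+ 3 ℕ.* p))))
      (alg (F a n) l (inv 9) (+ (2 ℕ.^ (p ℕ.+ 1) ℕ.+ 2 ℕ.+ 3 ℕ.* p)) E P h (inverse 9 ∤9)
        (≡⇒≈ (cong₂ (λ x y → x + + 2 + y) 2^[p+1]≡2E (ℤ.pos-* 3 p))))
    where
    alg : ∀ {m} F l i A E P → + 9 * F ≈ - (l * (+ 2 * E + + 2 + + 3 * P)) [ m ] → i * + 9 ≈ + 1 [ m ] →
      A ≈ + 2 * E + + 2 + + 3 * P [ m ] → F ≈ - (i * l * A) [ m ]
    alg F l i A E P h hi hA =
      linear (i · h ⊞ (- F) · hi ⊞ (i * l) · hA) (solve (F ∷ l ∷ i ∷ A ∷ E ∷ P ∷ []))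

  private
    ×1 : ∀ x → x ≡ + 1 * x
    ×1 x = sym (ℤ.*-identityˡ x)
    ×-1 : ∀ x → - x ≡ - + 1 * x
    ×-1 x = solve (x ∷ [])
    ×-1′ : ∀ x → x ≡ - (- + 1 * x)
    ×-1′ x = solve (x ∷ [])

    leg3-represents : ∀ {x l} → leg3 p ≡ x → Represents x l → Represents (leg3 p) l
    leg3-represents {l = l} e h = subst (λ x → Represents x l) (sym e) h

  -- n modulo 3 fixes p modulo 6: n = 3r gives p = 6r + 1 and n = 3r + 2 gives p = 6r + 5. The
  -- argument for 1/6 is based at r, the one for 1/3 at 2r or 2r + 1.
  sum-t2-t3 : ∀ {m} → m ≡ n →
    (Σ≤ m t2 ≡ (1 /ℕ 9) ℚ.* leg3 p ℚ.* ((2 ℕ.^ (p ℕ.+ 1)) /ℕ 1 ℚ.- (7 ℕ.+ 6 ℕ.* p) /ℕ 1) [mod p ℕ.^ 2 ∣ p ])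
    × (Σ≤ m t3 ≡ ℚ.- ((1 /ℕ 9) ℚ.* leg3 p ℚ.* ((2 ℕ.^ (p ℕ.+ 1) ℕ.+ 2 ℕ.+ 3 ℕ.* p) /ℕ 1)) [mod p ℕ.^ 2 ∣ p ])
  sum-t2-t3 refl with n divMod 3
  ... | result r zero e =
    sum-t2-from (+ 1) leg (represents-t2 1 (2 ℕ.* r) refl (cong suc 6r≡2n))
      (≈-trans (F-third₁ E PD≈2E-4 (2 ℕ.* r) t₃ 2r≤n 6r≡2n (minus-inverse 3 ∤3)) (≡⇒≈ (×1 _))) ,
    sum-t3-from (+ 1) leg (represents-t3 1 r refl (cong suc (trans (regroup r) 6r≡2n)))
      (≈-trans (F-sixth₁ E PD≈2E-4 r t₆ 3r≡n (minus-inverse 6 ∤6)) (≡⇒≈ (cong -_ (×1 _))))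
    where
    3r≡n : 3 ℕ.* r ≡ n
    3r≡n = trans (ℕ.*-comm 3 r) (sym e)
    swap : ∀ r → 3 ℕ.* (2 ℕ.* r) ≡ 2 ℕ.* (3 ℕ.* r)
    swap = ℕ-Solver.solve-∀
    regroup : ∀ r → 6 ℕ.* r ≡ 3 ℕ.* (2 ℕ.* r)
    regroup = ℕ-Solver.solve-∀
    6r≡2n : 3 ℕ.* (2 ℕ.* r) ≡ 2 ℕ.* n
    6r≡2n = trans (swap r) (cong (2 ℕ.*_) 3r≡n)
    2r≤n : 2 ℕ.* r ≤ n
    2r≤n = ℕ.≤-trans (ℕ.*-monoˡ-≤ r (ℕ.n≤1+n 2)) (ℕ.≤-reflexive 3r≡n)
    leg : Represents (leg3 p) (+ 1)
    leg = leg3-represents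
      (leg3-1 p (trans (cong (λ x → suc x % 3) (trans (sym 6r≡2n) (ℕ.*-comm 3 (2 ℕ.* r)))) ([m+kn]%n≡m%n 1 (2 ℕ.* r) 3)))
      represents-1
  -- For n = 3r + 1, p = 3(2r + 1) would be a multiple of 3.
  ... | result r (suc zero) e = contradiction 3∣p 3∤p
    where
    triple : ∀ r → suc (2 ℕ.* (1 ℕ.+ r ℕ.* 3)) ≡ suc (2 ℕ.* r) ℕ.* 3
    triple = ℕ-Solver.solve-∀
    3∣p : 3 ∣ p
    3∣p = divides (suc (2 ℕ.* r)) (trans (cong (λ x → suc (2 ℕ.* x)) e) (triple r))
    3∤p : ¬ 3 ∣ p
    3∤p 3∣p with prime⇒irreducible prime-p 3∣p
    ... | inj₂ 3≡p = ℕ.<⇒≢ p>3 3≡p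
  ... | result r (suc (suc zero)) e =
    sum-t2-from (- + 1) leg (represents-t2 2 (suc (2 ℕ.* r)) refl (cong suc 6r+4≡2n))
      (≈-trans (F-third₂ E PD≈2E-4 (suc (2 ℕ.* r)) t₃ 2r+1<n 6r+4≡2n (minus-inverse 3 ∤3)) (≡⇒≈ (×-1 _))) ,
    sum-t3-from (- + 1) leg (represents-t3 5 r refl (cong suc (trans (regroup r) 6r+4≡2n)))
      (≈-trans (F-sixth₂ E PD≈2E-4 r t₆ 3r+2≡n (minus-inverse 6 ∤6)) (≡⇒≈ (×-1′ _)))
    where
    3r+2≡n : 2 ℕ.+ 3 ℕ.* r ≡ n
    3r+2≡n = trans (cong (2 ℕ.+_) (ℕ.*-comm 3 r)) (sym e)
    swap : ∀ r → suc (3 ℕ.* suc (2 ℕ.* r)) ≡ 2 ℕ.* (2 ℕ.+ 3 ℕ.* r)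
    swap = ℕ-Solver.solve-∀
    regroup : ∀ r → 4 ℕ.+ 6 ℕ.* r ≡ suc (3 ℕ.* suc (2 ℕ.* r))
    regroup = ℕ-Solver.solve-∀
    6r+4≡2n : suc (3 ℕ.* suc (2 ℕ.* r)) ≡ 2 ℕ.* n
    6r+4≡2n = trans (swap r) (cong (2 ℕ.*_) 3r+2≡n)
    2r+1<n : suc (2 ℕ.* r) < n
    2r+1<n = ℕ.≤-trans (s≤s (s≤s (ℕ.*-monoˡ-≤ r (ℕ.n≤1+n 2)))) (ℕ.≤-reflexive 3r+2≡n)
    leg : Represents (leg3 p) (- + 1)
    leg = leg3-represents
      (leg3-2 p (trans (cong (λ x → suc x % 3) (trans (sym 6r+4≡2n) (cong suc (ℕ.*-comm 3 (suc (2 ℕ.* r))))))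
        ([m+kn]%n≡m%n 2 (suc (2 ℕ.* r)) 3)))
      (represents-neg represents-1)

odd-prime : ∀ p → Prime p → p > 3 → ∃ λ n → p ≡ suc (2 ℕ.* n)
odd-prime p prime-p p>3 with p divMod 2
... | result n (suc zero) e = n , trans e (cong suc (ℕ.*-comm n 2))
... | result n zero e with prime⇒irreducible prime-p (divides n e)
...   | inj₂ 2≡p = contradiction 2≡p (ℕ.<⇒≢ (ℕ.<-trans ℕ.≤-refl p>3))

theorem4p3 : (p : ℕ) → Prime p → p > 3 →
    (Σ≤ ((p ∸ 1) / 2) t1 ≡ ℚpow (ℚ.- 1ℚ) ((p ℕ.+ 1) / 2) ℚ.* (((p ℕ.+ 1) / 2) /ℕ 1) [mod p ^ 2 ∣ p ])
    × (Σ≤ ((p ∸ 1) / 2) t2 ≡ (1 /ℕ 9) ℚ.* leg3 p ℚ.* ((2 ^ (p ℕ.+ 1)) /ℕ 1 ℚ.- (7 ℕ.+ 6 ℕ.* p) /ℕ 1) [mod p ^ 2 ∣ p ])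
    × (Σ≤ ((p ∸ 1) / 2) t3 ≡ ℚ.- ((1 /ℕ 9) ℚ.* leg3 p ℚ.* ((2 ^ (p ℕ.+ 1) ℕ.+ 2 ℕ.+ 3 ℕ.* p) /ℕ 1)) [mod p ^ 2 ∣ p ])
theorem4p3 p prime-p p>3 with odd-prime p prime-p p>3
... | n , refl = sum-t1 half half-suc , sum-t2-t3 half
  where
  open Sums n prime-p p>3
  half : 2 ℕ.* n / 2 ≡ n
  half = trans (cong (_/ 2) (ℕ.*-comm 2 n)) (ℕ.m*n/n≡m n 2)
  expand : ∀ n → suc (2 ℕ.* n) ℕ.+ 1 ≡ suc n ℕ.* 2
  expand = ℕ-Solver.solve-∀
  half-suc : (suc (2 ℕ.* n) ℕ.+ 1) / 2 ≡ suc n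
  half-suc = trans (cong (_/ 2) (expand n)) (ℕ.m*n/n≡m (suc n) 2)
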